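{- Let $f_1,\dots,f_n$ be nondecreasing linear functions. A permutation $\sigma$ of $[n]$ is minimum if and only if it is locally optimal.
   Context: A linear function is $f(x)=ax+b$; nondecreasing means $a\ge0$. For a permutation $\sigma$, $f^\sigma=f_{\sigma(n)}\circ\cdots\circ f_{\sigma(1)}$; $\sigma$ is minimum if $f^\sigma\le f^\rho$ pointwise for all permutations $\rho$. For $1\le\ell\le m<r\le n$, $\sigma_{\ell,m,r}$ is obtained from $\sigma$ by swapping the adjacent blocks $(\sigma(\ell),\dots,\sigma(m))$ and $(\sigma(m+1),\dots,\sigma(r))$: $\sigma_{\ell,m,r}(i)=\sigma(i)$ for $i<\ell$ or $i>r$, $=\sigma(i-\ell+m+1)$ for $\ell\le i<\ell-m+r$, $=\sigma(i+m-r)$ for $\ell-m+r\le i\le r$. $\sigma$ is locally optimal if $f^\sigma\le f^{\sigma_{\ell,m,r}}$ pointwise for all such $\ell,m,r$. -}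

module Defs where

open import Data.Bool.Base using (true; false; if_then_else_; _∨_)
open import Data.Fin.Base as Fin using (Fin; toℕ; fromℕ<)
open import Data.Fin.Permutation using (Permutation′; permutation; _⟨$⟩ʳ_; _∘ₚ_)
open import Data.Fin.Properties using (toℕ<n; toℕ-fromℕ<; toℕ-injective)
open import Data.Nat.Base as ℕ using (ℕ; suc)
import Data.Nat.Properties as ℕ
open import Data.Nat.Tactic.RingSolver using (solve-∀)
open import Data.Product.Base using (∃; _×_; _,_; proj₁; proj₂)
open import Data.Rational.Base as ℚ
  using (ℚ; 0ℚ; 1ℚ; ½; Positive; ∣_∣; 1/_)
import Data.Rational.Properties as ℚ
open import Data.Rational.Solver using (module +-*-Solver)
open import Data.Vec.Functional using (foldl)
open import Relation.Binary.PropositionalEquality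
  using (_≡_; refl; sym; trans; cong; cong₂; subst; module ≡-Reasoning)
open import Relation.Nullary using (yes; no; does)
open import Relation.Nullary.Decidable using (dec-true; dec-false)

------------------------------------------------------------------------
-- Real numbers: Cauchy sequences of rationals, equipped with a modulus.
-- Cauchy sequences x and y denote the same real when x ≤ y and y ≤ x.

IsCauchy : (ℕ → ℚ) → Set
IsCauchy x = ∀ ε → .{{Positive ε}} →
  ∃ λ N → ∀ i j → N ℕ.≤ i → N ℕ.≤ j → ∣ x i ℚ.- x j ∣ ℚ.≤ ε

record ℝ : Set where
  constructor mkℝ
  field
    seq    : ℕ → ℚ
    cauchy : IsCauchy seq

open ℝ public

infix 4 _≤_

_≤_ : ℝ → ℝ → Set
x ≤ y = ∀ ε → .{{Positive ε}} →
  ∃ λ N → ∀ i → N ℕ.≤ i → seq x i ℚ.≤ seq y i ℚ.+ ε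

fromℚ : ℚ → ℝ
fromℚ q = mkℝ (λ _ → q) λ ε → 0 , λ _ _ _ _ →
  ℚ.≤-trans (ℚ.≤-reflexive (cong ∣_∣ (ℚ.+-inverseʳ q))) (ℚ.<⇒≤ (ℚ.positive⁻¹ ε))

0ℝ : ℝ
0ℝ = fromℚ 0ℚ

half+half : ∀ ε → ½ ℚ.* ε ℚ.+ ½ ℚ.* ε ≡ ε
half+half ε = trans (sym (ℚ.*-distribʳ-+ ε ½ ½)) (ℚ.*-identityˡ ε)

half-pos : ∀ ε → .{{Positive ε}} → Positive (½ ℚ.* ε)
half-pos ε = ℚ.pos*pos⇒pos ½ ε

+-cauchy : ∀ {x y} → IsCauchy x → IsCauchy y → IsCauchy (λ i → x i ℚ.+ y i)
+-cauchy {x} {y} cx cy ε = M ℕ.⊔ N , λ i j h k → begin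
  ∣ (x i ℚ.+ y i) ℚ.- (x j ℚ.+ y j) ∣
    ≡⟨ cong ∣_∣ (rearrange (x i) (y i) (x j) (y j)) ⟩
  ∣ (x i ℚ.- x j) ℚ.+ (y i ℚ.- y j) ∣
    ≤⟨ ℚ.∣p+q∣≤∣p∣+∣q∣ (x i ℚ.- x j) (y i ℚ.- y j) ⟩
  ∣ x i ℚ.- x j ∣ ℚ.+ ∣ y i ℚ.- y j ∣
    ≤⟨ ℚ.+-mono-≤
         (x-close i j (ℕ.m⊔n≤o⇒m≤o M N h) (ℕ.m⊔n≤o⇒m≤o M N k))
         (y-close i j (ℕ.m⊔n≤o⇒n≤o M N h) (ℕ.m⊔n≤o⇒n≤o M N k)) ⟩
  ½ ℚ.* ε ℚ.+ ½ ℚ.* ε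
    ≡⟨ half+half ε ⟩
  ε ∎
  where
  open ℚ.≤-Reasoning
  instance _ = half-pos ε
  M = proj₁ (cx (½ ℚ.* ε))
  N = proj₁ (cy (½ ℚ.* ε))
  x-close = proj₂ (cx (½ ℚ.* ε))
  y-close = proj₂ (cy (½ ℚ.* ε))
  rearrange : ∀ a b c d →
    (a ℚ.+ b) ℚ.- (c ℚ.+ d) ≡ (a ℚ.- c) ℚ.+ (b ℚ.- d)
  rearrange = solve 4 (λ a b c d →
    (a :+ b) :- (c :+ d) := (a :- c) :+ (b :- d)) refl
    where open +-*-Solver

eventually-bounded : ∀ {x} → IsCauchy x →
  ∃ λ B → Positive B × (∃ λ N → ∀ i → N ℕ.≤ i → ∣ x i ∣ ℚ.≤ B)
eventually-bounded {x} cx = B , B-pos , N , λ i h → begin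
  ∣ x i ∣
    ≡⟨ cong ∣_∣ (split (x i) (x N)) ⟩
  ∣ x N ℚ.+ (x i ℚ.- x N) ∣
    ≤⟨ ℚ.∣p+q∣≤∣p∣+∣q∣ (x N) (x i ℚ.- x N) ⟩
  ∣ x N ∣ ℚ.+ ∣ x i ℚ.- x N ∣
    ≤⟨ ℚ.+-monoʳ-≤ ∣ x N ∣ (proj₂ (cx 1ℚ) i N h ℕ.≤-refl) ⟩
  B ∎
  where
  open ℚ.≤-Reasoning
  N = proj₁ (cx 1ℚ)
  B = ∣ x N ∣ ℚ.+ 1ℚ
  B-pos : Positive B
  B-pos = ℚ.positive (ℚ.+-mono-≤-< (ℚ.0≤∣p∣ (x N)) (ℚ.positive⁻¹ 1ℚ))
  split : ∀ a b → a ≡ b ℚ.+ (a ℚ.- b)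
  split = solve 2 (λ a b → a := b :+ (a :- b)) refl
    where open +-*-Solver

*-shrink : ∀ B ε → .{{Positive B}} → .{{Positive ε}} →
  ∃ λ δ → Positive δ × B ℚ.* δ ≡ ε
*-shrink B ε = 1/ B ℚ.* ε , ℚ.pos*pos⇒pos (1/ B) {{ℚ.1/pos⇒pos B}} ε ,
  trans (sym (ℚ.*-assoc B (1/ B) ε))
    (trans (cong (ℚ._* ε) (ℚ.*-inverseʳ B)) (ℚ.*-identityˡ ε))
  where instance _ = ℚ.pos⇒nonZero B

∣p*q∣-bound : ∀ p q {B δ} → Positive B →
  ∣ p ∣ ℚ.≤ B → ∣ q ∣ ℚ.≤ δ → ∣ p ℚ.* q ∣ ℚ.≤ B ℚ.* δ
∣p*q∣-bound p q {B} {δ} B-pos p≤B q≤δ = begin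
  ∣ p ℚ.* q ∣
    ≡⟨ ℚ.∣p*q∣≡∣p∣*∣q∣ p q ⟩
  ∣ p ∣ ℚ.* ∣ q ∣
    ≤⟨ ℚ.*-monoʳ-≤-nonNeg ∣ q ∣ {{ℚ.nonNegative (ℚ.0≤∣p∣ q)}} p≤B ⟩
  B ℚ.* ∣ q ∣
    ≤⟨ ℚ.*-monoˡ-≤-nonNeg B {{ℚ.pos⇒nonNeg B {{B-pos}}}} q≤δ ⟩
  B ℚ.* δ ∎
  where open ℚ.≤-Reasoning

∣pq-rs∣-bound : ∀ p q r s {A B γ δ ε} → Positive A → Positive B →
  A ℚ.* δ ≡ ½ ℚ.* ε → B ℚ.* γ ≡ ½ ℚ.* ε →
  ∣ p ∣ ℚ.≤ A → ∣ s ∣ ℚ.≤ B → ∣ p ℚ.- r ∣ ℚ.≤ γ → ∣ q ℚ.- s ∣ ℚ.≤ δ →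
  ∣ p ℚ.* q ℚ.- r ℚ.* s ∣ ℚ.≤ ε
∣pq-rs∣-bound p q r s {A} {B} {γ} {δ} {ε} A-pos B-pos Aδ Bγ p≤A s≤B p-r≤γ q-s≤δ = begin
  ∣ p ℚ.* q ℚ.- r ℚ.* s ∣
    ≡⟨ cong ∣_∣ (rearrange p q r s) ⟩
  ∣ p ℚ.* (q ℚ.- s) ℚ.+ s ℚ.* (p ℚ.- r) ∣
    ≤⟨ ℚ.∣p+q∣≤∣p∣+∣q∣ (p ℚ.* (q ℚ.- s)) (s ℚ.* (p ℚ.- r)) ⟩
  ∣ p ℚ.* (q ℚ.- s) ∣ ℚ.+ ∣ s ℚ.* (p ℚ.- r) ∣
    ≤⟨ ℚ.+-mono-≤ (∣p*q∣-bound p (q ℚ.- s) A-pos p≤A q-s≤δ)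
                  (∣p*q∣-bound s (p ℚ.- r) B-pos s≤B p-r≤γ) ⟩
  A ℚ.* δ ℚ.+ B ℚ.* γ
    ≡⟨ cong₂ ℚ._+_ Aδ Bγ ⟩
  ½ ℚ.* ε ℚ.+ ½ ℚ.* ε
    ≡⟨ half+half ε ⟩
  ε ∎
  where
  open ℚ.≤-Reasoning
  rearrange : ∀ a b c d →
    a ℚ.* b ℚ.- c ℚ.* d ≡ a ℚ.* (b ℚ.- d) ℚ.+ d ℚ.* (a ℚ.- c)
  rearrange = solve 4 (λ a b c d →
    a :* b :- c :* d := a :* (b :- d) :+ d :* (a :- c)) refl
    where open +-*-Solver

*-cauchy : ∀ {x y} → IsCauchy x → IsCauchy y → IsCauchy (λ i → x i ℚ.* y i)
*-cauchy {x} {y} cx cy ε =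
  let A , A-pos , K , x-bound = eventually-bounded {x} cx
      B , B-pos , L , y-bound = eventually-bounded {y} cy
      δ , δ-pos , Aδ = *-shrink A (½ ℚ.* ε) {{A-pos}} {{half-pos ε}}
      γ , γ-pos , Bγ = *-shrink B (½ ℚ.* ε) {{B-pos}} {{half-pos ε}}
      M , x-close = cx γ {{γ-pos}}
      N , y-close = cy δ {{δ-pos}}
  in (K ℕ.⊔ L) ℕ.⊔ (M ℕ.⊔ N) , λ i j h k →
  let h₁ = ℕ.m⊔n≤o⇒m≤o (K ℕ.⊔ L) (M ℕ.⊔ N) h
      h₂ = ℕ.m⊔n≤o⇒n≤o (K ℕ.⊔ L) (M ℕ.⊔ N) h
      k₁ = ℕ.m⊔n≤o⇒m≤o (K ℕ.⊔ L) (M ℕ.⊔ N) k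
      k₂ = ℕ.m⊔n≤o⇒n≤o (K ℕ.⊔ L) (M ℕ.⊔ N) k
  in ∣pq-rs∣-bound (x i) (y i) (x j) (y j) {A} {B} {γ} {δ} {ε} A-pos B-pos Aδ Bγ
       (x-bound i (ℕ.m⊔n≤o⇒m≤o K L h₁))
       (y-bound j (ℕ.m⊔n≤o⇒n≤o K L k₁))
       (x-close i j (ℕ.m⊔n≤o⇒m≤o M N h₂) (ℕ.m⊔n≤o⇒m≤o M N k₂))
       (y-close i j (ℕ.m⊔n≤o⇒n≤o M N h₂) (ℕ.m⊔n≤o⇒n≤o M N k₂))

infixl 6 _+_
infixl 7 _*_

_+_ : ℝ → ℝ → ℝ
x + y = mkℝ (λ i → seq x i ℚ.+ seq y i)
            (+-cauchy {seq x} {seq y} (cauchy x) (cauchy y))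

_*_ : ℝ → ℝ → ℝ
x * y = mkℝ (λ i → seq x i ℚ.* seq y i)
            (*-cauchy {seq x} {seq y} (cauchy x) (cauchy y))

------------------------------------------------------------------------
-- Linear functions and their compositions

record LinearFunction : Set where
  constructor linear
  field
    slope     : ℝ
    intercept : ℝ

  apply : ℝ → ℝ
  apply x = slope * x + intercept

  Nondecreasing : Set
  Nondecreasing = 0ℝ ≤ slope

open LinearFunction public

-- f_σ(n) ∘ ⋯ ∘ f_σ(1): the function with index σ(1) is applied first.
compose : ∀ {n} → (Fin n → LinearFunction) → Permutation′ n → ℝ → ℝ
compose f σ x = foldl (λ y i → apply (f i) y) x (σ ⟨$⟩ʳ_)

------------------------------------------------------------------------
-- Swapping adjacent blocks

-- σ_{ℓ,m,r}(i) = σ(swapIndex ℓ m r i).  The map is given by the same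
-- formula whether positions are counted from 0 or from 1, and no
-- subtraction truncates when ℓ ≤ m < r.
swapIndex : (ℓ m r : ℕ) → ℕ → ℕ
swapIndex ℓ m r i =
  if does (i ℕ.<? ℓ) ∨ does (r ℕ.<? i) then i
  else if does (i ℕ.<? (ℓ ℕ.+ r ℕ.∸ m)) then i ℕ.+ suc m ℕ.∸ ℓ
  else i ℕ.+ m ℕ.∸ r

module _ (ℓ p q : ℕ) where

  -- The blocks have p + 1 and q + 1 entries.
  private
    m = ℓ ℕ.+ p
    r = suc (ℓ ℕ.+ p ℕ.+ q)

    boundary : ℓ ℕ.+ r ℕ.∸ m ≡ ℓ ℕ.+ suc q
    boundary = trans (cong (ℕ._∸ m) (eq ℓ p q)) (ℕ.m+n∸m≡n m (ℓ ℕ.+ suc q))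
      where
      eq : ∀ ℓ p q → ℓ ℕ.+ (suc (ℓ ℕ.+ p ℕ.+ q)) ≡ ℓ ℕ.+ p ℕ.+ (ℓ ℕ.+ suc q)
      eq = solve-∀

    lastIndex : ℓ ℕ.+ suc q ℕ.+ p ≡ r
    lastIndex = eq ℓ p q
      where
      eq : ∀ ℓ p q → ℓ ℕ.+ suc q ℕ.+ p ≡ suc (ℓ ℕ.+ p ℕ.+ q)
      eq = solve-∀

  data Position : ℕ → Set where
    before : ∀ {i} → i ℕ.< ℓ → Position i
    after  : ∀ {i} → r ℕ.< i → Position i
    left   : ∀ {j} → j ℕ.≤ q → Position (ℓ ℕ.+ j)
    right  : ∀ {k} → k ℕ.≤ p → Position (ℓ ℕ.+ suc q ℕ.+ k)

  position : ∀ i → Position i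
  position i with i ℕ.<? ℓ
  ... | yes i<ℓ = before i<ℓ
  ... | no  i≮ℓ with ℕ.m≤n⇒∃[o]m+o≡n (ℕ.≮⇒≥ i≮ℓ)
  ... | j , refl with j ℕ.≤? q
  ... | yes j≤q = left j≤q
  ... | no  j≰q with ℕ.m≤n⇒∃[o]m+o≡n (ℕ.≰⇒> j≰q)
  ... | k , refl with k ℕ.≤? p
  ... | yes k≤p = subst Position (ℕ.+-assoc ℓ (suc q) k) (right k≤p)
  ... | no  k≰p = after (subst (ℕ._< ℓ ℕ.+ (suc q ℕ.+ k)) (eq ℓ p q)
                    (ℕ.+-monoʳ-< ℓ (ℕ.+-monoʳ-< (suc q) (ℕ.≰⇒> k≰p))))
    where
    eq : ∀ ℓ p q → ℓ ℕ.+ (suc q ℕ.+ p) ≡ suc (ℓ ℕ.+ p ℕ.+ q)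
    eq = solve-∀

  swap-before : ∀ {i} → i ℕ.< ℓ → swapIndex ℓ m r i ≡ i
  swap-before {i} h rewrite dec-true (i ℕ.<? ℓ) h = refl

  swap-after : ∀ {i} → r ℕ.< i → swapIndex ℓ m r i ≡ i
  swap-after {i} h with does (i ℕ.<? ℓ)
  ... | true  = refl
  ... | false rewrite dec-true (r ℕ.<? i) h = refl

  swap-left : ∀ {j} → j ℕ.≤ q → swapIndex ℓ m r (ℓ ℕ.+ j) ≡ ℓ ℕ.+ suc p ℕ.+ j
  swap-left {j} h
    rewrite dec-false (ℓ ℕ.+ j ℕ.<? ℓ) (ℕ.m+n≮m ℓ j)
          | dec-false (r ℕ.<? ℓ ℕ.+ j) (ℕ.≤⇒≯ (ℕ.m≤n⇒m≤1+n (ℕ.+-mono-≤ (ℕ.m≤m+n ℓ p) h)))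
          | boundary
          | dec-true (ℓ ℕ.+ j ℕ.<? ℓ ℕ.+ suc q) (ℕ.+-monoʳ-< ℓ (ℕ.s≤s h))
          = trans (cong (ℕ._∸ ℓ) (eq ℓ p j)) (ℕ.m+n∸m≡n ℓ _)
    where
    eq : ∀ ℓ p j → ℓ ℕ.+ j ℕ.+ suc (ℓ ℕ.+ p) ≡ ℓ ℕ.+ (ℓ ℕ.+ suc p ℕ.+ j)
    eq = solve-∀

  swap-right : ∀ {k} → k ℕ.≤ p → swapIndex ℓ m r (ℓ ℕ.+ suc q ℕ.+ k) ≡ ℓ ℕ.+ k
  swap-right {k} h
    rewrite dec-false (ℓ ℕ.+ suc q ℕ.+ k ℕ.<? ℓ)
              (ℕ.≤⇒≯ (ℕ.≤-trans (ℕ.m≤m+n ℓ (suc q)) (ℕ.m≤m+n _ k)))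
          | dec-false (r ℕ.<? ℓ ℕ.+ suc q ℕ.+ k)
              (ℕ.≤⇒≯ (subst (ℓ ℕ.+ suc q ℕ.+ k ℕ.≤_) lastIndex (ℕ.+-monoʳ-≤ (ℓ ℕ.+ suc q) h)))
          | boundary
          | dec-false (ℓ ℕ.+ suc q ℕ.+ k ℕ.<? ℓ ℕ.+ suc q) (ℕ.m+n≮m (ℓ ℕ.+ suc q) k)
          = trans (cong (ℕ._∸ r) (eq ℓ p q k)) (ℕ.m+n∸m≡n r _)
    where
    eq : ∀ ℓ p q k → ℓ ℕ.+ suc q ℕ.+ k ℕ.+ (ℓ ℕ.+ p) ≡ suc (ℓ ℕ.+ p ℕ.+ q) ℕ.+ (ℓ ℕ.+ k)
    eq = solve-∀

  swap-bound : ∀ {n i} → r ℕ.< n → i ℕ.< n → swapIndex ℓ m r i ℕ.< n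
  swap-bound {n} {i} r<n i<n with position i
  ... | before h rewrite swap-before h = i<n
  ... | after h  rewrite swap-after h = i<n
  ... | left {j} h rewrite swap-left h =
    ℕ.≤-<-trans (subst (ℓ ℕ.+ suc p ℕ.+ j ℕ.≤_) (eq ℓ p q) (ℕ.+-monoʳ-≤ (ℓ ℕ.+ suc p) h)) r<n
    where
    eq : ∀ ℓ p q → ℓ ℕ.+ suc p ℕ.+ q ≡ suc (ℓ ℕ.+ p ℕ.+ q)
    eq = solve-∀
  ... | right {k} h rewrite swap-right h =
    ℕ.≤-<-trans (ℕ.≤-trans (ℕ.+-monoʳ-≤ ℓ h) (ℕ.m≤n⇒m≤1+n (ℕ.m≤m+n (ℓ ℕ.+ p) q))) r<n

swap-inverse : ∀ ℓ p q i →
  swapIndex ℓ (ℓ ℕ.+ q) (suc (ℓ ℕ.+ q ℕ.+ p))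
    (swapIndex ℓ (ℓ ℕ.+ p) (suc (ℓ ℕ.+ p ℕ.+ q)) i) ≡ i
swap-inverse ℓ p q i with position ℓ p q i
... | before h rewrite swap-before ℓ p q h = swap-before ℓ q p h
... | after h  rewrite swap-after ℓ p q h =
  swap-after ℓ q p (subst (ℕ._< i) (eq ℓ p q) h)
  where
  eq : ∀ ℓ p q → suc (ℓ ℕ.+ p ℕ.+ q) ≡ suc (ℓ ℕ.+ q ℕ.+ p)
  eq = solve-∀
... | left h  rewrite swap-left ℓ p q h = swap-right ℓ q p h
... | right h rewrite swap-right ℓ p q h = swap-left ℓ q p h

module _ {n : ℕ} where

  swapIndex-bound : ∀ {ℓ m r i} → ℓ ℕ.≤ m → m ℕ.< r → r ℕ.< n →
    i ℕ.< n → swapIndex ℓ m r i ℕ.< n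
  swapIndex-bound {ℓ} ℓ≤m m<r r<n i<n
    with ℕ.m≤n⇒∃[o]m+o≡n ℓ≤m
  ... | p , refl with ℕ.m≤n⇒∃[o]m+o≡n m<r
  ... | q , refl = swap-bound ℓ p q r<n i<n

  swapFin : ∀ {ℓ m r} → ℓ ℕ.≤ m → m ℕ.< r → r ℕ.< n → Fin n → Fin n
  swapFin {ℓ} {m} {r} ℓ≤m m<r r<n i =
    fromℕ< (swapIndex-bound {ℓ} {m} {r} ℓ≤m m<r r<n (toℕ<n i))

  toℕ-swapFin : ∀ {ℓ m r} (ℓ≤m : ℓ ℕ.≤ m) (m<r : m ℕ.< r) (r<n : r ℕ.< n) i →
    toℕ (swapFin ℓ≤m m<r r<n i) ≡ swapIndex ℓ m r (toℕ i)
  toℕ-swapFin ℓ≤m m<r r<n i = toℕ-fromℕ< _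

  swapFin-inverse : ∀ {ℓ m m′ r}
    (ℓ≤m : ℓ ℕ.≤ m) (m<r : m ℕ.< r) (ℓ≤m′ : ℓ ℕ.≤ m′) (m′<r : m′ ℕ.< r)
    (r<n : r ℕ.< n) → m ℕ.+ suc m′ ≡ ℓ ℕ.+ r →
    ∀ i → swapFin ℓ≤m′ m′<r r<n (swapFin ℓ≤m m<r r<n i) ≡ i
  swapFin-inverse {ℓ} {m} {m′} {r} ℓ≤m m<r ℓ≤m′ m′<r r<n eq i = toℕ-injective (begin
    toℕ (swapFin ℓ≤m′ m′<r r<n (swapFin ℓ≤m m<r r<n i))
      ≡⟨ toℕ-swapFin ℓ≤m′ m′<r r<n _ ⟩
    swapIndex ℓ m′ r (toℕ (swapFin ℓ≤m m<r r<n i))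
      ≡⟨ cong (swapIndex ℓ m′ r) (toℕ-swapFin ℓ≤m m<r r<n i) ⟩
    swapIndex ℓ m′ r (swapIndex ℓ m r (toℕ i))
      ≡⟨ inverse ℓ≤m m<r eq (toℕ i) ⟩
    toℕ i ∎)
    where
    open ≡-Reasoning
    lemma : ∀ ℓ p q → ℓ ℕ.+ suc (ℓ ℕ.+ p ℕ.+ q) ≡ ℓ ℕ.+ p ℕ.+ suc (ℓ ℕ.+ q)
    lemma = solve-∀
    inverse : ∀ {ℓ m m′ r} → ℓ ℕ.≤ m → m ℕ.< r → m ℕ.+ suc m′ ≡ ℓ ℕ.+ r →
      ∀ i → swapIndex ℓ m′ r (swapIndex ℓ m r i) ≡ i
    inverse {ℓ} {m} {m′} ℓ≤m m<r eq i
      with ℕ.m≤n⇒∃[o]m+o≡n ℓ≤m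
    ... | p , refl with ℕ.m≤n⇒∃[o]m+o≡n m<r
    ... | q , refl
      with refl ← ℕ.suc-injective (ℕ.+-cancelˡ-≡ (ℓ ℕ.+ p) (suc m′) (suc (ℓ ℕ.+ q))
                    (trans eq (lemma ℓ p q)))
      = subst (λ r → swapIndex ℓ (ℓ ℕ.+ q) r
                       (swapIndex ℓ (ℓ ℕ.+ p) (suc (ℓ ℕ.+ p ℕ.+ q)) i) ≡ i)
          (cong suc (comm ℓ q p)) (swap-inverse ℓ p q i)
      where
      comm : ∀ ℓ q p → ℓ ℕ.+ q ℕ.+ p ≡ ℓ ℕ.+ p ℕ.+ q
      comm = solve-∀

  blockSwap : (ℓ m r : Fin n) → ℓ Fin.≤ m → m Fin.< r → Permutation′ n
  blockSwap ℓ m r ℓ≤m m<r = permutation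
    (swapFin ℓ≤m m<r r<n)
    (swapFin ℓ≤m′ m′<r r<n)
    (swapFin-inverse ℓ≤m′ m′<r ℓ≤m m<r r<n (trans (flip (toℕ m) m′) sum))
    (swapFin-inverse ℓ≤m m<r ℓ≤m′ m′<r r<n sum)
    where
    r<n = toℕ<n r

    -- The last position of the first block after the swap.
    m′ = toℕ ℓ ℕ.+ toℕ r ℕ.∸ suc (toℕ m)

    sum : toℕ m ℕ.+ suc m′ ≡ toℕ ℓ ℕ.+ toℕ r
    sum = trans (ℕ.+-suc (toℕ m) m′)
      (ℕ.m+[n∸m]≡n (ℕ.≤-trans m<r (ℕ.m≤n+m (toℕ r) (toℕ ℓ))))

    flip : ∀ a b → b ℕ.+ suc a ≡ a ℕ.+ suc b
    flip = solve-∀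

    ℓ≤m′ : toℕ ℓ ℕ.≤ m′
    ℓ≤m′ = ℕ.≤-trans (ℕ.m≤m+n (toℕ ℓ) (toℕ r ℕ.∸ suc (toℕ m)))
      (ℕ.≤-reflexive (sym (ℕ.+-∸-assoc (toℕ ℓ) m<r)))

    m′<r : m′ ℕ.< toℕ r
    m′<r = ℕ.+-cancelˡ-≤ (toℕ m) (suc m′) (toℕ r)
      (ℕ.≤-trans (ℕ.≤-reflexive sum) (ℕ.+-monoˡ-≤ (toℕ r) ℓ≤m))

-- σ_{ℓ,m,r}: _∘ₚ_ applies its left argument first, so i ↦ σ (blockSwap i).
swapBlocks : ∀ {n} → Permutation′ n → (ℓ m r : Fin n) →
  ℓ Fin.≤ m → m Fin.< r → Permutation′ n
swapBlocks σ ℓ m r ℓ≤m m<r = blockSwap ℓ m r ℓ≤m m<r ∘ₚ σ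

------------------------------------------------------------------------
-- Minimum and locally optimal permutations

infix 4 _≤̇_

_≤̇_ : (ℝ → ℝ) → (ℝ → ℝ) → Set
g ≤̇ h = ∀ x → g x ≤ h x

IsMinimum : ∀ {n} → (Fin n → LinearFunction) → Permutation′ n → Set
IsMinimum f σ = ∀ ρ → compose f σ ≤̇ compose f ρ

IsLocallyOptimal : ∀ {n} → (Fin n → LinearFunction) → Permutation′ n → Set
IsLocallyOptimal f σ = ∀ ℓ m r (ℓ≤m : ℓ Fin.≤ m) (m<r : m Fin.< r) →
  compose f σ ≤̇ compose f (swapBlocks σ ℓ m r ℓ≤m m<r)

{-# OPTIONS --safe #-}
module Submission where

-- Attach to x ↦ a x + b the vector (b , 1 - a).  The vector of a composite is a
-- nonnegative combination of those of its factors, and swapping adjacent blocks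
-- A , B followed by Z raises the value by slope Z · det A B.  Let i ∷ j ∷ W be
-- locally optimal.
--
-- If all slopes after i are positive, the three-term Plücker relation shows that
-- no vector lies strictly between those of i and j.  Hence in a minimum
-- arrangement (which exists up to double negation) i can be moved at no cost
-- either directly in front of j or to the very end.  In the first case i and j
-- are replaced by their composite, in the second i is dropped, and induction on
-- the number of functions applies.
--
-- If some slope after i vanishes, let c be the value reached in j ∷ W right after
-- the last such function and t its final value.  Local optimality says i(c) ≥ c
-- and i(t) ≥ t, so i(y) ≥ y for all y between t and c; by induction no arrangement
-- without i ends below t, and it follows that inserting i does not help.
--
-- Since _≤_ is stable under double negation, case distinctions on inequalities
-- are available whenever an inequality is to be proved.

open import Defs
open import Data.Fin.Base as Fin using (Fin; zero; suc; toℕ; fromℕ<; punchIn)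
open import Data.Fin.Permutation using (Permutation′; _⟨$⟩ʳ_; remove; punchIn-permute)
open import Data.Fin.Properties using (toℕ<n; toℕ-fromℕ<)
import Data.Integer.Base as ℤ
open import Data.List.Base using (List; []; _∷_; _++_; [_]; length; map; concatMap; tabulate)
open import Data.List.Membership.Propositional using (_∈_; find; lose)
open import Data.List.Membership.Propositional.Properties
  using (∈-∃++; ∈-++⁻; ∈-insert; ∈-map⁺; ∈-map⁻; ∈-concatMap⁺; ∈-concatMap⁻)
open import Data.List.Properties
  using (++-assoc; ++-identityʳ; length-++; length-tabulate; tabulate-cong)
open import Data.List.Relation.Binary.Permutation.Propositional as ↭
  using (_↭_; ↭-refl; ↭-sym; ↭-trans; ↭-reflexive; prep; swap)
open import Data.List.Relation.Binary.Permutation.Propositional.Properties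
  using ( shift; shifts; ++-comm; drop-mid; ++⁺ˡ; ↭-length; ↭-empty-inv; ↭-singleton-inv
        ; ∈-resp-↭; All-resp-↭)
open import Data.List.Relation.Unary.All as All using (All; []; _∷_)
import Data.List.Relation.Unary.All.Properties as All
open import Data.List.Relation.Unary.Any using (here; there)
open import Data.Maybe.Base using (Maybe; just; nothing)
open import Data.Maybe.Properties using (just-injective)
open import Data.Nat.Base as ℕ using (ℕ; zero; suc)
import Data.Nat.Properties as ℕ
open import Data.Nat.Tactic.RingSolver using (solve-∀)
open import Data.Product.Base using (∃; _×_; _,_; proj₁; proj₂)
open import Data.Rational.Base as ℚ using (ℚ; 0ℚ; 1ℚ; ½; Positive; ∣_∣)
import Data.Rational.Properties as ℚ
open import Data.Rational.Solver using (module +-*-Solver)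
open import Data.Sum.Base using (_⊎_; inj₁; inj₂)
open import Data.Vec.Functional using (foldl; head; tail)
open import Function.Base using (_∘_)
open import Function.Bundles using (_⇔_; mk⇔)
open import Relation.Binary.PropositionalEquality
  using (_≡_; refl; sym; trans; cong; cong₂; subst; subst₂; module ≡-Reasoning)
open import Relation.Nullary using (¬_; Dec; yes; no; contradiction)

open +-*-Solver using (solve; _:+_; _:*_; _:-_; _:=_; con; Polynomial)

-- Rational inequalities

≤-from-gap : ∀ {p q} t → 0ℚ ℚ.≤ t → p ℚ.+ t ≡ q → p ℚ.≤ q
≤-from-gap {p} t 0≤t eq =
  subst (p ℚ.≤_) eq (subst (ℚ._≤ p ℚ.+ t) (ℚ.+-identityʳ p) (ℚ.+-monoʳ-≤ p 0≤t))

0≤+ : ∀ {p q} → 0ℚ ℚ.≤ p → 0ℚ ℚ.≤ q → 0ℚ ℚ.≤ p ℚ.+ q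
0≤+ = ℚ.+-mono-≤

0≤* : ∀ {p q} → 0ℚ ℚ.≤ p → 0ℚ ℚ.≤ q → 0ℚ ℚ.≤ p ℚ.* q
0≤* {p} {q} 0≤p 0≤q = ℚ.nonNegative⁻¹ (p ℚ.* q)
  {{ℚ.nonNeg*nonNeg⇒nonNeg p {{ℚ.nonNegative 0≤p}} q {{ℚ.nonNegative 0≤q}}}}

0≤-gap : ∀ {p q} → p ℚ.≤ q → 0ℚ ℚ.≤ q ℚ.- p
0≤-gap {p} {q} p≤q =
  subst (ℚ._≤ q ℚ.- p) (ℚ.+-inverseʳ p) (ℚ.+-monoˡ-≤ (ℚ.- p) p≤q)

p≤∣p∣ : ∀ p → p ℚ.≤ ∣ p ∣
p≤∣p∣ p with ℚ.≤-total 0ℚ p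
... | inj₁ 0≤p = ℚ.≤-reflexive (sym (ℚ.0≤p⇒∣p∣≡p 0≤p))
... | inj₂ p≤0 = ℚ.≤-trans p≤0 (ℚ.0≤∣p∣ p)

0≤pos : ∀ ε → .{{Positive ε}} → 0ℚ ℚ.≤ ε
0≤pos ε = ℚ.<⇒≤ (ℚ.positive⁻¹ ε)

-- Negativity with a witness, as opposed to the mere negation of 0ℝ ≤ x.
record EventuallyNegative (x : ℝ) : Set where
  constructor negative
  field
    gap        : ℚ
    gap-pos    : Positive gap
    from       : ℕ
    below-zero : ∀ i → from ℕ.≤ i → seq x i ℚ.+ gap ℚ.≤ 0ℚ

-- Order and arithmetic of Cauchy sequences

≤-pointwise : ∀ x y → (∀ i → seq x i ≡ seq y i) → x ≤ y
≤-pointwise x y x≡y ε = 0 , λ i _ →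
  ≤-from-gap ε (0≤pos ε) (cong (ℚ._+ ε) (x≡y i))

≤-transᴿ : ∀ x y z → x ≤ y → y ≤ z → x ≤ z
≤-transᴿ x y z x≤y y≤z ε = M ℕ.⊔ N , λ i h →
  ≤-from-gap _
    (0≤+ (0≤-gap (x≤y′ i (ℕ.m⊔n≤o⇒m≤o M N h)))
         (0≤-gap (y≤z′ i (ℕ.m⊔n≤o⇒n≤o M N h))))
    (eq (seq x i) (seq y i) (seq z i) ε)
  where
  instance _ = half-pos ε
  M = proj₁ (x≤y (½ ℚ.* ε))
  N = proj₁ (y≤z (½ ℚ.* ε))
  x≤y′ = proj₂ (x≤y (½ ℚ.* ε))
  y≤z′ = proj₂ (y≤z (½ ℚ.* ε))
  eq : ∀ x y z ε → x ℚ.+ ((y ℚ.+ ½ ℚ.* ε ℚ.- x) ℚ.+ (z ℚ.+ ½ ℚ.* ε ℚ.- y)) ≡ z ℚ.+ ε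
  eq = solve 4 (λ x y z ε →
    x :+ ((y :+ con ½ :* ε :- x) :+ (z :+ con ½ :* ε :- y)) := z :+ ε) refl

+-mono-≤ᴿ : ∀ x y u v → x ≤ y → u ≤ v → x + u ≤ y + v
+-mono-≤ᴿ x y u v x≤y u≤v ε = M ℕ.⊔ N , λ i h →
  ≤-from-gap _
    (0≤+ (0≤-gap (x≤y′ i (ℕ.m⊔n≤o⇒m≤o M N h)))
         (0≤-gap (u≤v′ i (ℕ.m⊔n≤o⇒n≤o M N h))))
    (eq (seq x i) (seq y i) (seq u i) (seq v i) ε)
  where
  instance _ = half-pos ε
  M = proj₁ (x≤y (½ ℚ.* ε))
  N = proj₁ (u≤v (½ ℚ.* ε))
  x≤y′ = proj₂ (x≤y (½ ℚ.* ε))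
  u≤v′ = proj₂ (u≤v (½ ℚ.* ε))
  eq : ∀ x y u v ε →
    (x ℚ.+ u) ℚ.+ ((y ℚ.+ ½ ℚ.* ε ℚ.- x) ℚ.+ (v ℚ.+ ½ ℚ.* ε ℚ.- u)) ≡ (y ℚ.+ v) ℚ.+ ε
  eq = solve 5 (λ x y u v ε →
    (x :+ u) :+ ((y :+ con ½ :* ε :- x) :+ (v :+ con ½ :* ε :- u)) := (y :+ v) :+ ε) refl

evNeg⇒≱0 : ∀ x → EventuallyNegative x → ¬ 0ℝ ≤ x
evNeg⇒≱0 x (negative γ γ-pos N x+γ≤0) 0≤x = ℚ.<-irrefl refl (ℚ.<-≤-trans (ℚ.positive⁻¹ (½ ℚ.* γ))
  (≤-from-gap {½ ℚ.* γ} {0ℚ} _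
    (0≤+ (0≤-gap (x+γ≤0 i (ℕ.m≤m⊔n N M))) (0≤-gap (0≤x′ i (ℕ.m≤n⊔m N M))))
    (eq (seq x i) γ)))
  where
  instance
    _ = γ-pos
    _ = half-pos γ
  M = proj₁ (0≤x (½ ℚ.* γ))
  0≤x′ = proj₂ (0≤x (½ ℚ.* γ))
  i = N ℕ.⊔ M
  eq : ∀ x γ → ½ ℚ.* γ ℚ.+ ((0ℚ ℚ.- (x ℚ.+ γ)) ℚ.+ (x ℚ.+ ½ ℚ.* γ ℚ.- 0ℚ)) ≡ 0ℚ
  eq = solve 2 (λ x γ →
    con ½ :* γ :+ ((con 0ℚ :- (x :+ γ)) :+ (x :+ con ½ :* γ :- con 0ℚ)) := con 0ℚ) refl

-- One rational comparison decides the matter. Past the index `N` the sequence moves by at most δ =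
-- ε/4. Either its term there is at least -2δ, and all later terms are at least -3δ, or it is below
-- -2δ, and all later terms are at most -δ. Stability of `_≤_` under double negation rests on this.
¬evNeg⇒0≤ : ∀ x → ¬ EventuallyNegative x → 0ℝ ≤ x
¬evNeg⇒0≤ x ¬neg ε = decide (0ℚ ℚ.≤? seq x N ℚ.+ (δ ℚ.+ δ))
  where
  δ = ½ ℚ.* (½ ℚ.* ε)
  δ-pos = half-pos (½ ℚ.* ε) {{half-pos ε}}
  N = proj₁ (cauchy x δ {{δ-pos}})
  close = proj₂ (cauchy x δ {{δ-pos}})
  eq₁ : ∀ a b ε → let δ = ½ ℚ.* (½ ℚ.* ε) in
    0ℚ ℚ.+ (a ℚ.+ (δ ℚ.+ δ) ℚ.+ (δ ℚ.- (a ℚ.- b) ℚ.+ δ)) ≡ b ℚ.+ ε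
  eq₁ = solve 3 (λ a b ε → let δ = con ½ :* (con ½ :* ε) in
    con 0ℚ :+ (a :+ (δ :+ δ) :+ (δ :- (a :- b) :+ δ)) := b :+ ε) refl
  eq₂ : ∀ a b δ →
    b ℚ.+ δ ℚ.+ (0ℚ ℚ.- (a ℚ.+ (δ ℚ.+ δ)) ℚ.+ (δ ℚ.- (b ℚ.- a))) ≡ 0ℚ
  eq₂ = solve 3 (λ a b δ →
    b :+ δ :+ (con 0ℚ :- (a :+ (δ :+ δ)) :+ (δ :- (b :- a))) := con 0ℚ) refl
  decide : Dec (0ℚ ℚ.≤ seq x N ℚ.+ (δ ℚ.+ δ)) →
    ∃ λ N → ∀ i → N ℕ.≤ i → 0ℚ ℚ.≤ seq x i ℚ.+ ε
  decide (yes 0≤) = N , λ i h → ≤-from-gap _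
    (0≤+ 0≤ (0≤+ (0≤-gap (ℚ.≤-trans (p≤∣p∣ _) (close N i ℕ.≤-refl h)))
                 (0≤pos δ {{δ-pos}})))
    (eq₁ (seq x N) (seq x i) ε)
  decide (no ≱0) = contradiction
    (negative δ δ-pos N λ i h → ≤-from-gap _
      (0≤+ (0≤-gap (ℚ.<⇒≤ (ℚ.≰⇒> ≱0)))
           (0≤-gap (ℚ.≤-trans (p≤∣p∣ _) (close i N h ℕ.≤-refl))))
      (eq₂ (seq x N) (seq x i) δ))
    ¬neg

-- Expanding (x + δ)(y + δ) ≥ 0 gives xy ≥ -δ(x + y) - δ², where x + y is eventually at most `B` and
-- δ ≤ 1.
0≤x*yᴿ : ∀ x y → 0ℝ ≤ x → 0ℝ ≤ y → 0ℝ ≤ x * y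
0≤x*yᴿ x y 0≤x 0≤y ε =
  let B , B-pos , K , bound = eventually-bounded {seq (x + y)} (cauchy (x + y))
      -- The summand `ε` ensures δ ≤ 1, because C δ = ε ≤ C.
      C = B ℚ.+ (1ℚ ℚ.+ ε)
      C-pos = ℚ.pos+pos⇒pos B {{B-pos}} (1ℚ ℚ.+ ε) {{ℚ.pos+pos⇒pos 1ℚ ε}}
      δ , δ-pos , Cδ≡ε = *-shrink C ε {{C-pos}}
      M , 0≤x+δ = 0≤x δ {{δ-pos}}
      N , 0≤y+δ = 0≤y δ {{δ-pos}}
      0≤δ = 0≤pos δ {{δ-pos}}
      δ≤1 = ℚ.*-cancelˡ-≤-pos {δ} {1ℚ} C {{C-pos}} (≤-from-gap (B ℚ.+ 1ℚ)
              (0≤+ (0≤pos B {{B-pos}}) (0≤pos 1ℚ))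
              (trans (cong (ℚ._+ (B ℚ.+ 1ℚ)) Cδ≡ε) (eq₁ B ε)))
  in K ℕ.⊔ (M ℕ.⊔ N) , λ i h →
  let h′ = ℕ.m⊔n≤o⇒n≤o K (M ℕ.⊔ N) h
  in ≤-from-gap _
    (0≤+ (0≤* (0≤x+δ i (ℕ.m⊔n≤o⇒m≤o M N h′)) (0≤y+δ i (ℕ.m⊔n≤o⇒n≤o M N h′)))
      (0≤+ (0≤* 0≤δ (0≤-gap (ℚ.≤-trans (p≤∣p∣ (seq x i ℚ.+ seq y i))
                               (bound i (ℕ.m⊔n≤o⇒m≤o K (M ℕ.⊔ N) h)))))
        (0≤+ (0≤* 0≤δ (0≤-gap δ≤1)) (0≤* 0≤δ (0≤pos ε)))))
    (trans (eq₂ (seq x i) (seq y i) B δ ε) (cong (seq x i ℚ.* seq y i ℚ.+_) Cδ≡ε))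
  where
  eq₁ : ∀ B ε → ε ℚ.+ (B ℚ.+ 1ℚ) ≡ (B ℚ.+ (1ℚ ℚ.+ ε)) ℚ.* 1ℚ
  eq₁ = solve 2 (λ B ε → ε :+ (B :+ con 1ℚ) := (B :+ (con 1ℚ :+ ε)) :* con 1ℚ) refl
  eq₂ : ∀ x y B δ ε →
    0ℚ ℚ.+ ((x ℚ.+ δ) ℚ.* (y ℚ.+ δ) ℚ.+ (δ ℚ.* (B ℚ.- (x ℚ.+ y)) ℚ.+ (δ ℚ.* (1ℚ ℚ.- δ) ℚ.+ δ ℚ.* ε)))
    ≡ x ℚ.* y ℚ.+ (B ℚ.+ (1ℚ ℚ.+ ε)) ℚ.* δ
  eq₂ = solve 5 (λ x y B δ ε →
    con 0ℚ :+ ((x :+ δ) :* (y :+ δ) :+ (δ :* (B :- (x :+ y)) :+ (δ :* (con 1ℚ :- δ) :+ δ :* ε)))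
    := x :* y :+ (B :+ (con 1ℚ :+ ε)) :* δ) refl

evNeg-* : ∀ x y → EventuallyNegative (0ℝ + fromℚ (ℚ.- 1ℚ) * x) → EventuallyNegative y → EventuallyNegative (x * y)
evNeg-* x y (negative δ δ-pos N δ≤x) (negative γ γ-pos M y+γ≤0) =
  negative (γ ℚ.* δ) (ℚ.pos*pos⇒pos γ {{γ-pos}} δ {{δ-pos}}) (M ℕ.⊔ N) λ i h →
    let a = 0≤-gap (y+γ≤0 i (ℕ.m⊔n≤o⇒m≤o M N h))
        b = 0≤-gap (δ≤x i (ℕ.m⊔n≤o⇒n≤o M N h))
    in ≤-from-gap _
      (0≤+ (0≤* a b) (0≤+ (0≤* a (0≤pos δ {{δ-pos}})) (0≤* (0≤pos γ {{γ-pos}}) b)))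
      (eq (seq x i) (seq y i) γ δ)
  where
  eq : ∀ x y γ δ → let a = 0ℚ ℚ.- (y ℚ.+ γ) ; b = 0ℚ ℚ.- (0ℚ ℚ.+ (ℚ.- 1ℚ) ℚ.* x ℚ.+ δ) in
    x ℚ.* y ℚ.+ γ ℚ.* δ ℚ.+ (a ℚ.* b ℚ.+ (a ℚ.* δ ℚ.+ γ ℚ.* b)) ≡ 0ℚ
  eq = solve 4 (λ x y γ δ →
    let a = con 0ℚ :- (y :+ γ) ; b = con 0ℚ :- (con 0ℚ :+ con (ℚ.- 1ℚ) :* x :+ δ) in
    x :* y :+ γ :* δ :+ (a :* b :+ (a :* δ :+ γ :* b)) := con 0ℚ) refl

evNeg⇒≤ : ∀ x y → EventuallyNegative (y + fromℚ (ℚ.- 1ℚ) * x) → y ≤ x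
evNeg⇒≤ x y (negative γ γ-pos N h) ε = N , λ i N≤i → ≤-from-gap _
  (0≤+ (0≤-gap (h i N≤i)) (0≤+ (0≤pos γ {{γ-pos}}) (0≤pos ε)))
  (eq (seq y i) (seq x i) γ ε)
  where
  eq : ∀ y x γ ε → y ℚ.+ ((0ℚ ℚ.- (y ℚ.+ (ℚ.- 1ℚ) ℚ.* x ℚ.+ γ)) ℚ.+ (γ ℚ.+ ε)) ≡ x ℚ.+ ε
  eq = solve 4 (λ y x γ ε → y :+ ((con 0ℚ :- (y :+ con (ℚ.- 1ℚ) :* x :+ γ)) :+ (γ :+ ε)) := x :+ ε) refl

-- The ordered ring of reals

-- The operations are opaque so that unification does not compare Cauchy proofs.

infix 4 _≼_ _≺_ _≈_
infixl 6 _⊕_ _⊖_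
infixl 7 _⊗_

opaque

  _⊕_ _⊖_ _⊗_ : ℝ → ℝ → ℝ
  x ⊕ y = x + y
  x ⊖ y = x + fromℚ (ℚ.- 1ℚ) * y
  x ⊗ y = x * y

  𝟎 𝟏 : ℝ
  𝟎 = 0ℝ
  𝟏 = fromℚ 1ℚ

  _≼_ : ℝ → ℝ → Set
  x ≼ y = x ≤ y

_≺_ : ℝ → ℝ → Set
x ≺ y = ¬ y ≼ x

-- Equality of representatives, which is all that ring identities need.
record _≈_ (x y : ℝ) : Set where
  constructor pointwise
  field at : ∀ i → seq x i ≡ seq y i

open _≈_ public

≈-refl : ∀ {x} → x ≈ x
≈-refl = pointwise λ _ → refl

≈-sym : ∀ {x y} → x ≈ y → y ≈ x
≈-sym x≈y = pointwise λ i → sym (at x≈y i)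

≈-trans : ∀ {x y z} → x ≈ y → y ≈ z → x ≈ z
≈-trans x≈y y≈z = pointwise λ i → trans (at x≈y i) (at y≈z i)

opaque
  unfolding _⊕_

  ≈⇒≼ : ∀ {x y} → x ≈ y → x ≼ y
  ≈⇒≼ {x} {y} x≈y = ≤-pointwise x y (at x≈y)

  ≼-trans : ∀ {x y z} → x ≼ y → y ≼ z → x ≼ z
  ≼-trans {x} {y} {z} = ≤-transᴿ x y z

  ⊕-mono-≼ : ∀ {x y u v} → x ≼ y → u ≼ v → x ⊕ u ≼ y ⊕ v
  ⊕-mono-≼ {x} {y} {u} {v} = +-mono-≤ᴿ x y u v

  ⊖-monoˡ-≼ : ∀ {x y} z → x ≼ y → x ⊖ z ≼ y ⊖ z
  ⊖-monoˡ-≼ {x} {y} z x≤y = +-mono-≤ᴿ x y -z -z x≤y (≤-pointwise -z -z λ _ → refl)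
    where
    -z : ℝ
    -z = fromℚ (ℚ.- 1ℚ) * z

  0≼x⊗y : ∀ {x y} → 𝟎 ≼ x → 𝟎 ≼ y → 𝟎 ≼ x ⊗ y
  0≼x⊗y {x} {y} = 0≤x*yᴿ x y

  ¬evNeg⇒0≼ : ∀ {x} → ¬ EventuallyNegative x → 𝟎 ≼ x
  ¬evNeg⇒0≼ {x} = ¬evNeg⇒0≤ x

  evNeg⇒𝟎⋠ : ∀ {x} → EventuallyNegative x → ¬ 𝟎 ≼ x
  evNeg⇒𝟎⋠ {x} = evNeg⇒≱0 x

  evNeg⇒≼ : ∀ {x y} → EventuallyNegative (y ⊖ x) → y ≼ x
  evNeg⇒≼ {x} {y} = evNeg⇒≤ x y

  evNeg-⊗ : ∀ {x y} → EventuallyNegative (𝟎 ⊖ x) → EventuallyNegative y →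
    EventuallyNegative (x ⊗ y)
  evNeg-⊗ {x} {y} (negative δ δ-pos N -x+δ≤0) =
    evNeg-* x y (negative δ δ-pos N -x+δ≤0)

  x⊖x≈𝟎 : ∀ x → x ⊖ x ≈ 𝟎
  x⊖x≈𝟎 x = pointwise λ i → eq (seq x i)
    where
    eq : ∀ x → x ℚ.+ (ℚ.- 1ℚ) ℚ.* x ≡ 0ℚ
    eq = solve 1 (λ x → x :+ con (ℚ.- 1ℚ) :* x := con 0ℚ) refl

  x⊕𝟎≈x : ∀ x → x ⊕ 𝟎 ≈ x
  x⊕𝟎≈x x = pointwise λ i → ℚ.+-identityʳ (seq x i)

  x⊕[y⊖x]≈y : ∀ x y → x ⊕ (y ⊖ x) ≈ y
  x⊕[y⊖x]≈y x y = pointwise λ i → eq (seq x i) (seq y i)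
    where
    eq : ∀ x y → x ℚ.+ (y ℚ.+ (ℚ.- 1ℚ) ℚ.* x) ≡ y
    eq = solve 2 (λ x y → x :+ (y :+ con (ℚ.- 1ℚ) :* x) := y) refl

≼-refl : ∀ {x} → x ≼ x
≼-refl = ≈⇒≼ ≈-refl

0≼-resp-≈ : ∀ {x y} → x ≈ y → 𝟎 ≼ x → 𝟎 ≼ y
0≼-resp-≈ x≈y 0≤x = ≼-trans 0≤x (≈⇒≼ x≈y)

x≼x⊕y : ∀ {x y} → 𝟎 ≼ y → x ≼ x ⊕ y
x≼x⊕y {x} 0≤y = ≼-trans (≈⇒≼ (≈-sym (x⊕𝟎≈x x))) (⊕-mono-≼ ≼-refl 0≤y)

0≼x⊕y : ∀ {x y} → 𝟎 ≼ x → 𝟎 ≼ y → 𝟎 ≼ x ⊕ y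
0≼x⊕y 0≤x 0≤y = ≼-trans 0≤x (x≼x⊕y 0≤y)

x≼y⇒0≼y⊖x : ∀ {x y} → x ≼ y → 𝟎 ≼ y ⊖ x
x≼y⇒0≼y⊖x {x} x≤y = ≼-trans (≈⇒≼ (≈-sym (x⊖x≈𝟎 x))) (⊖-monoˡ-≼ x x≤y)

0≼y⊖x⇒x≼y : ∀ {x y} → 𝟎 ≼ y ⊖ x → x ≼ y
0≼y⊖x⇒x≼y {x} {y} 0≤y-x = ≼-trans (x≼x⊕y 0≤y-x) (≈⇒≼ (x⊕[y⊖x]≈y x y))

≼-stable : ∀ {x y} → ¬ ¬ x ≼ y → x ≼ y
≼-stable ¬¬x≤y = 0≼y⊖x⇒x≼y
  (¬evNeg⇒0≼ λ neg → ¬¬x≤y λ x≤y → evNeg⇒𝟎⋠ neg (x≼y⇒0≼y⊖x x≤y))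

≺⇒≼ : ∀ {x y} → x ≺ y → x ≼ y
≺⇒≼ y≰x = 0≼y⊖x⇒x≼y (¬evNeg⇒0≼ λ neg → y≰x (evNeg⇒≼ neg))

-- If `y` were eventually negative, `x` could not be eventually positive without making the product
-- eventually negative; but then `x ≼ 𝟎`.
0≼-cancelˡ : ∀ {x y} → 𝟎 ≺ x → 𝟎 ≼ x ⊗ y → 𝟎 ≼ y
0≼-cancelˡ 0<x 0≤xy = ¬evNeg⇒0≼ λ y<0 →
  0<x (0≼y⊖x⇒x≼y (¬evNeg⇒0≼ λ -x<0 → evNeg⇒𝟎⋠ (evNeg-⊗ -x<0 y<0) 0≤xy))

-- Excluded middle for an arbitrary `P`, paid for by the stability of the goal.
≼-by-cases : ∀ {P : Set} {u v} → (P → u ≼ v) → (¬ P → u ≼ v) → u ≼ v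
≼-by-cases f g = ≼-stable λ u≰v → u≰v (g λ p → u≰v (f p))

-- Consequences of the order axioms

-- Mirrors the encoding of `_⊖_` as addition of -1 times the subtrahend, so that solved identities
-- have the shape to which the real operations unfold.
_⊝_ : ∀ {n} → Polynomial n → Polynomial n → Polynomial n
x ⊝ y = x :+ con (ℚ.- 1ℚ) :* y

opaque
  unfolding _⊕_

  [x⊕y]⊖x≈y : ∀ x y → x ⊕ y ⊖ x ≈ y
  [x⊕y]⊖x≈y x y = pointwise λ i → eq (seq x i) (seq y i)
    where
    eq : ∀ x y → x ℚ.+ y ℚ.+ (ℚ.- 1ℚ) ℚ.* x ≡ y
    eq = solve 2 (λ x y → (x :+ y) ⊝ x := y) refl

  x⊗[𝟎⊖y]≈𝟎⊖x⊗y : ∀ x y → x ⊗ (𝟎 ⊖ y) ≈ 𝟎 ⊖ x ⊗ y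
  x⊗[𝟎⊖y]≈𝟎⊖x⊗y x y = pointwise λ i → eq (seq x i) (seq y i)
    where
    eq : ∀ x y → x ℚ.* (0ℚ ℚ.+ (ℚ.- 1ℚ) ℚ.* y) ≡ 0ℚ ℚ.+ (ℚ.- 1ℚ) ℚ.* (x ℚ.* y)
    eq = solve 2 (λ x y → x :* (con 0ℚ ⊝ y) := con 0ℚ ⊝ (x :* y)) refl

  [𝟎⊖x]⊗y≈𝟎⊖x⊗y : ∀ x y → (𝟎 ⊖ x) ⊗ y ≈ 𝟎 ⊖ x ⊗ y
  [𝟎⊖x]⊗y≈𝟎⊖x⊗y x y = pointwise λ i → eq (seq x i) (seq y i)
    where
    eq : ∀ x y → (0ℚ ℚ.+ (ℚ.- 1ℚ) ℚ.* x) ℚ.* y ≡ 0ℚ ℚ.+ (ℚ.- 1ℚ) ℚ.* (x ℚ.* y)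
    eq = solve 2 (λ x y → (con 0ℚ ⊝ x) :* y := con 0ℚ ⊝ (x :* y)) refl

  x⊗[y⊖z]≈x⊗y⊖x⊗z : ∀ x y z → x ⊗ (y ⊖ z) ≈ x ⊗ y ⊖ x ⊗ z
  x⊗[y⊖z]≈x⊗y⊖x⊗z x y z = pointwise λ i → eq (seq x i) (seq y i) (seq z i)
    where
    eq : ∀ x y z → x ℚ.* (y ℚ.+ (ℚ.- 1ℚ) ℚ.* z) ≡ x ℚ.* y ℚ.+ (ℚ.- 1ℚ) ℚ.* (x ℚ.* z)
    eq = solve 3 (λ x y z → x :* (y ⊝ z) := (x :* y) ⊝ (x :* z)) refl

  𝟎≺𝟏 : 𝟎 ≺ 𝟏
  𝟎≺𝟏 1≤0 with N , 1≤½ ← 1≤0 ½ with 1≤½ N ℕ.≤-refl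
  ... | ℚ.*≤* (ℤ.+≤+ (ℕ.s≤s ()))

x≼y≈z⇒x≼z : ∀ {x y z} → x ≼ y → y ≈ z → x ≼ z
x≼y≈z⇒x≼z x≤y y≈z = ≼-trans x≤y (≈⇒≼ y≈z)

x≈y≼z⇒x≼z : ∀ {x y z} → x ≈ y → y ≼ z → x ≼ z
x≈y≼z⇒x≼z x≈y y≤z = ≼-trans (≈⇒≼ x≈y) y≤z

x≼x⊕y⇒0≼y : ∀ {x y} → x ≼ x ⊕ y → 𝟎 ≼ y
x≼x⊕y⇒0≼y {x} {y} x≤x+y = 0≼-resp-≈ ([x⊕y]⊖x≈y x y) (x≼y⇒0≼y⊖x x≤x+y)

x⊕y≼x : ∀ {x y} → y ≼ 𝟎 → x ⊕ y ≼ x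
x⊕y≼x {x} y≤0 = x≼y≈z⇒x≼z (⊕-mono-≼ ≼-refl y≤0) (x⊕𝟎≈x x)

⊗-monoʳ-≼ : ∀ {x y z} → 𝟎 ≼ x → y ≼ z → x ⊗ y ≼ x ⊗ z
⊗-monoʳ-≼ {x} {y} {z} 0≤x y≤z = 0≼y⊖x⇒x≼y
  (0≼-resp-≈ (x⊗[y⊖z]≈x⊗y⊖x⊗z x z y) (0≼x⊗y 0≤x (x≼y⇒0≼y⊖x y≤z)))

≺-resp-≈ : ∀ {x y} → x ≈ y → 𝟎 ≺ x → 𝟎 ≺ y
≺-resp-≈ x≈y 0<x y≤0 = 0<x (x≈y≼z⇒x≼z x≈y y≤0)

x≼0⇒x⊗y≼0 : ∀ {x y} → x ≼ 𝟎 → 𝟎 ≼ y → x ⊗ y ≼ 𝟎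
x≼0⇒x⊗y≼0 {x} {y} x≤0 0≤y = 0≼y⊖x⇒x≼y
  (0≼-resp-≈ ([𝟎⊖x]⊗y≈𝟎⊖x⊗y x y) (0≼x⊗y (x≼y⇒0≼y⊖x x≤0) 0≤y))

y≼0⇒x⊗y≼0 : ∀ {x y} → 𝟎 ≼ x → y ≼ 𝟎 → x ⊗ y ≼ 𝟎
y≼0⇒x⊗y≼0 {x} {y} 0≤x y≤0 = 0≼y⊖x⇒x≼y
  (0≼-resp-≈ (x⊗[𝟎⊖y]≈𝟎⊖x⊗y x y) (0≼x⊗y 0≤x (x≼y⇒0≼y⊖x y≤0)))

0≺x⊗y : ∀ {x y} → 𝟎 ≺ x → 𝟎 ≺ y → 𝟎 ≺ x ⊗ y
0≺x⊗y {x} {y} 0<x 0<y xy≤0 = 0<y (0≼y⊖x⇒x≼y (0≼-cancelˡ 0<x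
  (0≼-resp-≈ (≈-sym (x⊗[𝟎⊖y]≈𝟎⊖x⊗y x y)) (x≼y⇒0≼y⊖x xy≤0))))

0≺x⊗y⇒0≺x : ∀ {x y} → 𝟎 ≼ y → 𝟎 ≺ x ⊗ y → 𝟎 ≺ x
0≺x⊗y⇒0≺x 0≤y 0<xy x≤0 = 0<xy (x≼0⇒x⊗y≼0 x≤0 0≤y)

0≺x⊗y⇒0≺y : ∀ {x y} → 𝟎 ≼ x → 𝟎 ≺ x ⊗ y → 𝟎 ≺ y
0≺x⊗y⇒0≺y 0≤x 0<xy y≤0 = 0<xy (y≼0⇒x⊗y≼0 0≤x y≤0)

-- The form in which the Plücker identities are contradicted: one positive term and a nonnegative
-- remainder.
0≺-sum-≉𝟎 : ∀ {x y} → 𝟎 ≼ x → 𝟎 ≺ y → ¬ y ⊕ x ≈ 𝟎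
0≺-sum-≉𝟎 0≤x 0<y y+x≈0 = 0<y (x≼y≈z⇒x≼z (x≼x⊕y 0≤x) y+x≈0)

-- Composites of lists and their determinants

opaque
  unfolding _⊕_

  -- The composite of a list of functions, its head being applied first, is
  -- x ↦ s A ⊗ x ⊕ b A.
  s b : List LinearFunction → ℝ
  s []      = 𝟏
  s (f ∷ A) = s A ⊗ slope f
  b []      = 𝟎
  b (f ∷ A) = s A ⊗ intercept f ⊕ b A

  -- The determinant of the vectors (b A , 1 - s A) and (b B , 1 - s B).
  det : List LinearFunction → List LinearFunction → ℝ
  det A B = b A ⊗ (𝟏 ⊖ s B) ⊖ b B ⊗ (𝟏 ⊖ s A)

_⨾_ : LinearFunction → LinearFunction → LinearFunction
f ⨾ g = linear (slope g ⊗ slope f) (slope g ⊗ intercept f ⊕ intercept g)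

opaque
  unfolding _⊕_ s

  s-++ : ∀ A B → s (A ++ B) ≈ s B ⊗ s A
  s-++ []      B = pointwise λ i → sym (ℚ.*-identityʳ (seq (s B) i))
  s-++ (f ∷ A) B = pointwise λ i →
    trans (cong (ℚ._* seq (slope f) i) (at (s-++ A B) i)) (ℚ.*-assoc (seq (s B) i) _ _)

  b-++ : ∀ A B → b (A ++ B) ≈ s B ⊗ b A ⊕ b B
  b-++ []      B = pointwise λ i → eq (seq (s B) i) (seq (b B) i)
    where
    eq : ∀ s b → b ≡ s ℚ.* 0ℚ ℚ.+ b
    eq = solve 2 (λ s b → b := s :* con 0ℚ :+ b) refl
  b-++ (f ∷ A) B = pointwise λ i →
    trans (cong₂ (λ x y → x ℚ.* seq (intercept f) i ℚ.+ y) (at (s-++ A B) i) (at (b-++ A B) i))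
      (eq (seq (s A) i) (seq (s B) i) (seq (intercept f) i) (seq (b A) i) (seq (b B) i))
    where
    eq : ∀ sA sB f bA bB →
      (sB ℚ.* sA) ℚ.* f ℚ.+ (sB ℚ.* bA ℚ.+ bB) ≡ sB ℚ.* (sA ℚ.* f ℚ.+ bA) ℚ.+ bB
    eq = solve 5 (λ sA sB f bA bB →
      (sB :* sA) :* f :+ (sB :* bA :+ bB) := sB :* (sA :* f :+ bA) :+ bB) refl

  𝟎≺s[] : 𝟎 ≺ s []
  𝟎≺s[] = 𝟎≺𝟏

  𝟎≼s[f] : ∀ f → 𝟎 ≼ slope f → 𝟎 ≼ s [ f ]
  𝟎≼s[f] f = 0≼-resp-≈ {slope f} {s [ f ]} (pointwise λ i → sym (ℚ.*-identityˡ (seq (slope f) i)))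

  ⨾-b : ∀ f g Z X → b (X ++ (f ⨾ g) ∷ Z) ≈ b (X ++ f ∷ g ∷ Z)
  ⨾-b f g Z X = pointwise λ i →
    trans (at (b-++ X ((f ⨾ g) ∷ Z)) i) (trans
      (eq (seq (s Z) i) (seq (b Z) i) (seq (slope g) i) (seq (slope f) i)
        (seq (intercept f) i) (seq (intercept g) i) (seq (b X) i))
      (sym (at (b-++ X (f ∷ g ∷ Z)) i)))
    where
    eq : ∀ sZ bZ ag af bf bg bX →
      (sZ ℚ.* (ag ℚ.* af)) ℚ.* bX ℚ.+ (sZ ℚ.* (ag ℚ.* bf ℚ.+ bg) ℚ.+ bZ)
      ≡ ((sZ ℚ.* ag) ℚ.* af) ℚ.* bX ℚ.+ ((sZ ℚ.* ag) ℚ.* bf ℚ.+ (sZ ℚ.* bg ℚ.+ bZ))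
    eq = solve 7 (λ sZ bZ ag af bf bg bX →
      (sZ :* (ag :* af)) :* bX :+ (sZ :* (ag :* bf :+ bg) :+ bZ)
      := ((sZ :* ag) :* af) :* bX :+ ((sZ :* ag) :* bf :+ (sZ :* bg :+ bZ))) refl

  ⨾-det : ∀ f g A B → det ((f ⨾ g) ∷ A) B ≈ det (f ∷ g ∷ A) B
  ⨾-det f g A B = pointwise λ i →
    cong₂ (λ x y → x ℚ.* (1ℚ ℚ.+ (ℚ.- 1ℚ) ℚ.* seq (s B) i)
             ℚ.+ (ℚ.- 1ℚ) ℚ.* (seq (b B) i ℚ.* (1ℚ ℚ.+ (ℚ.- 1ℚ) ℚ.* y)))
      (at (⨾-b f g A []) i)
      (sym (ℚ.*-assoc (seq (s A) i) (seq (slope g) i) (seq (slope f) i)))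

  det-self : ∀ A → det A A ≈ 𝟎
  det-self A = pointwise λ i → eq (seq (s A) i) (seq (b A) i)
    where
    eq : ∀ s b → b ℚ.* (1ℚ ℚ.+ (ℚ.- 1ℚ) ℚ.* s)
      ℚ.+ (ℚ.- 1ℚ) ℚ.* (b ℚ.* (1ℚ ℚ.+ (ℚ.- 1ℚ) ℚ.* s)) ≡ 0ℚ
    eq = solve 2 (λ s b → (b :* (con 1ℚ ⊝ s)) ⊝ (b :* (con 1ℚ ⊝ s)) := con 0ℚ) refl

  det-anti : ∀ A B → det A B ≈ 𝟎 ⊖ det B A
  det-anti A B = pointwise λ i → eq (seq (s A) i) (seq (b A) i) (seq (s B) i) (seq (b B) i)
    where
    eq : ∀ sA bA sB bB →
      bA ℚ.* (1ℚ ℚ.+ (ℚ.- 1ℚ) ℚ.* sB) ℚ.+ (ℚ.- 1ℚ) ℚ.* (bB ℚ.* (1ℚ ℚ.+ (ℚ.- 1ℚ) ℚ.* sA))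
      ≡ 0ℚ ℚ.+ (ℚ.- 1ℚ) ℚ.*
        (bB ℚ.* (1ℚ ℚ.+ (ℚ.- 1ℚ) ℚ.* sA) ℚ.+ (ℚ.- 1ℚ) ℚ.* (bA ℚ.* (1ℚ ℚ.+ (ℚ.- 1ℚ) ℚ.* sB)))
    eq = solve 4 (λ sA bA sB bB →
      (bA :* (con 1ℚ ⊝ sB)) ⊝ (bB :* (con 1ℚ ⊝ sA))
      := con 0ℚ ⊝ ((bB :* (con 1ℚ ⊝ sA)) ⊝ (bA :* (con 1ℚ ⊝ sB)))) refl

  -- Bilinearity: the vector of `A ++ B` is `s B` times that of `A` plus that of `B`.
  det-++ˡ : ∀ A B C → det (A ++ B) C ≈ s B ⊗ det A C ⊕ det B C
  det-++ˡ A B C = pointwise λ i →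
    trans (cong₂ (λ x y → x ℚ.* (1ℚ ℚ.+ (ℚ.- 1ℚ) ℚ.* seq (s C) i)
                   ℚ.+ (ℚ.- 1ℚ) ℚ.* (seq (b C) i ℚ.* (1ℚ ℚ.+ (ℚ.- 1ℚ) ℚ.* y)))
            (at (b-++ A B) i) (at (s-++ A B) i))
      (eq (seq (s A) i) (seq (b A) i) (seq (s B) i) (seq (b B) i) (seq (s C) i) (seq (b C) i))
    where
    eq : ∀ sA bA sB bB sC bC →
      (sB ℚ.* bA ℚ.+ bB) ℚ.* (1ℚ ℚ.+ (ℚ.- 1ℚ) ℚ.* sC)
        ℚ.+ (ℚ.- 1ℚ) ℚ.* (bC ℚ.* (1ℚ ℚ.+ (ℚ.- 1ℚ) ℚ.* (sB ℚ.* sA)))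
      ≡ sB ℚ.* (bA ℚ.* (1ℚ ℚ.+ (ℚ.- 1ℚ) ℚ.* sC) ℚ.+ (ℚ.- 1ℚ) ℚ.* (bC ℚ.* (1ℚ ℚ.+ (ℚ.- 1ℚ) ℚ.* sA)))
        ℚ.+ (bB ℚ.* (1ℚ ℚ.+ (ℚ.- 1ℚ) ℚ.* sC) ℚ.+ (ℚ.- 1ℚ) ℚ.* (bC ℚ.* (1ℚ ℚ.+ (ℚ.- 1ℚ) ℚ.* sB)))
    eq = solve 6 (λ sA bA sB bB sC bC →
      ((sB :* bA :+ bB) :* (con 1ℚ ⊝ sC)) ⊝ (bC :* (con 1ℚ ⊝ (sB :* sA)))
      := sB :* ((bA :* (con 1ℚ ⊝ sC)) ⊝ (bC :* (con 1ℚ ⊝ sA)))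
         :+ ((bB :* (con 1ℚ ⊝ sC)) ⊝ (bC :* (con 1ℚ ⊝ sB)))) refl

  det-++ʳ : ∀ A B C → det A (B ++ C) ≈ s C ⊗ det A B ⊕ det A C
  det-++ʳ A B C = pointwise λ i →
    trans (at (det-anti A (B ++ C)) i)
    (trans (cong (λ x → 0ℚ ℚ.+ (ℚ.- 1ℚ) ℚ.* x) (at (det-++ˡ B C A) i))
    (trans (eq (seq (s C) i) (seq (det B A) i) (seq (det C A) i))
      (sym (cong₂ (λ x y → seq (s C) i ℚ.* x ℚ.+ y) (at (det-anti A B) i) (at (det-anti A C) i)))))
    where
    eq : ∀ c x y → 0ℚ ℚ.+ (ℚ.- 1ℚ) ℚ.* (c ℚ.* x ℚ.+ y)
      ≡ c ℚ.* (0ℚ ℚ.+ (ℚ.- 1ℚ) ℚ.* x) ℚ.+ (0ℚ ℚ.+ (ℚ.- 1ℚ) ℚ.* y)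
    eq = solve 3 (λ c x y → con 0ℚ ⊝ (c :* x :+ y) := c :* (con 0ℚ ⊝ x) :+ (con 0ℚ ⊝ y)) refl

  plücker : ∀ A B C D →
    det A B ⊗ det C D ⊕ det A C ⊗ det D B ⊕ det A D ⊗ det B C ≈ 𝟎
  plücker A B C D = pointwise λ i →
    eq (seq (s A) i) (seq (b A) i) (seq (s B) i) (seq (b B) i)
       (seq (s C) i) (seq (b C) i) (seq (s D) i) (seq (b D) i)
    where
    d : ℚ → ℚ → ℚ → ℚ → ℚ
    d s b s′ b′ = b ℚ.* (1ℚ ℚ.+ (ℚ.- 1ℚ) ℚ.* s′) ℚ.+ (ℚ.- 1ℚ) ℚ.* (b′ ℚ.* (1ℚ ℚ.+ (ℚ.- 1ℚ) ℚ.* s))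
    d′ : ∀ {n} → Polynomial n → Polynomial n → Polynomial n → Polynomial n → Polynomial n
    d′ s b s′ b′ = (b :* (con 1ℚ ⊝ s′)) ⊝ (b′ :* (con 1ℚ ⊝ s))
    eq : ∀ sA bA sB bB sC bC sD bD →
      d sA bA sB bB ℚ.* d sC bC sD bD ℚ.+ d sA bA sC bC ℚ.* d sD bD sB bB
        ℚ.+ d sA bA sD bD ℚ.* d sB bB sC bC ≡ 0ℚ
    eq = solve 8 (λ sA bA sB bB sC bC sD bD →
      d′ sA bA sB bB :* d′ sC bC sD bD :+ d′ sA bA sC bC :* d′ sD bD sB bB
        :+ d′ sA bA sD bD :* d′ sB bB sC bC := con 0ℚ) refl

  b-++-++-++ : ∀ X A B Z → b (X ++ A ++ B ++ Z) ≈
    (s Z ⊗ s B) ⊗ s A ⊗ b X ⊕ ((s Z ⊗ s B) ⊗ b A ⊕ (s Z ⊗ b B ⊕ b Z))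
  b-++-++-++ X A B Z = pointwise λ i →
    trans (at (b-++ X (A ++ B ++ Z)) i)
      (cong₂ (λ x y → x ℚ.* seq (b X) i ℚ.+ y)
        (trans (at (s-++ A (B ++ Z)) i) (cong (ℚ._* seq (s A) i) (at (s-++ B Z) i)))
        (trans (at (b-++ A (B ++ Z)) i)
          (cong₂ (λ x y → x ℚ.* seq (b A) i ℚ.+ y) (at (s-++ B Z) i) (at (b-++ B Z) i))))

  -- Slopes commute, so the contributions of `X` and `Z` agree on both sides. What remains is
  -- `s A ⊗ b B ⊕ b A` against `s B ⊗ b A ⊕ b B`, scaled by `s Z`.
  b-swap : ∀ X A B Z → b (X ++ B ++ A ++ Z) ≈ b (X ++ A ++ B ++ Z) ⊕ s Z ⊗ det A B
  b-swap X A B Z = pointwise λ i →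
    trans (at (b-++-++-++ X B A Z) i)
    (trans (eq (seq (b X) i) (seq (s A) i) (seq (b A) i) (seq (s B) i) (seq (b B) i)
               (seq (s Z) i) (seq (b Z) i))
    (cong (ℚ._+ seq (s Z ⊗ det A B) i) (sym (at (b-++-++-++ X A B Z) i))))
    where
    eq : ∀ bX sA bA sB bB sZ bZ →
      ((sZ ℚ.* sA) ℚ.* sB) ℚ.* bX ℚ.+ ((sZ ℚ.* sA) ℚ.* bB ℚ.+ (sZ ℚ.* bA ℚ.+ bZ))
      ≡ ((sZ ℚ.* sB) ℚ.* sA) ℚ.* bX ℚ.+ ((sZ ℚ.* sB) ℚ.* bA ℚ.+ (sZ ℚ.* bB ℚ.+ bZ))
        ℚ.+ sZ ℚ.* (bA ℚ.* (1ℚ ℚ.+ (ℚ.- 1ℚ) ℚ.* sB) ℚ.+ (ℚ.- 1ℚ) ℚ.* (bB ℚ.* (1ℚ ℚ.+ (ℚ.- 1ℚ) ℚ.* sA)))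
    eq = solve 7 (λ bX sA bA sB bB sZ bZ →
      ((sZ :* sA) :* sB) :* bX :+ ((sZ :* sA) :* bB :+ (sZ :* bA :+ bZ))
      := ((sZ :* sB) :* sA) :* bX :+ ((sZ :* sB) :* bA :+ (sZ :* bB :+ bZ))
         :+ sZ :* ((bA :* (con 1ℚ ⊝ sB)) ⊝ (bB :* (con 1ℚ ⊝ sA)))) refl

  det-absorbˡ : ∀ A B → det A (A ++ B) ≈ det A B
  det-absorbˡ A B = pointwise λ i →
    trans (at (det-++ʳ A A B) i)
    (trans (cong (λ x → seq (s B) i ℚ.* x ℚ.+ seq (det A B) i) (at (det-self A) i))
    (eq (seq (s B) i) (seq (det A B) i)))
    where
    eq : ∀ c x → c ℚ.* 0ℚ ℚ.+ x ≡ x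
    eq = solve 2 (λ c x → c :* con 0ℚ :+ x := x) refl

  -- s k times the Plücker relation for i , j , j ++ W , k.
  cone-identity : ∀ i j W k →
    det i k ⊗ det k j
      ⊕ (s k ⊗ (det i j ⊗ det (j ++ W) k)
         ⊕ (det i k ⊗ det j (W ++ k) ⊕ s k ⊗ (det i (j ++ W) ⊗ det k j))) ≈ 𝟎
  cone-identity i j W k = pointwise λ n → let d = λ x z → seq (det x z) n in
    trans (cong (λ x → d i k ℚ.* d k j ℚ.+ (seq (s k) n ℚ.* (d i j ℚ.* d (j ++ W) k)
        ℚ.+ (d i k ℚ.* x ℚ.+ seq (s k) n ℚ.* (d i (j ++ W) ℚ.* d k j))))
      -- `det j (W ++ k)` equals `s k ⊗ det j (j ++ W) ⊖ det k j`, and its second part cancels the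
      -- leading product.
      (trans (at (det-++ʳ j W k) n)
        (cong₂ (λ x y → seq (s k) n ℚ.* x ℚ.+ y) (sym (at (det-absorbˡ j W) n)) (at (det-anti j k) n))))
    (trans (eq₁ (seq (s k) n) (d i j) (d i k) (d k j) (d (j ++ W) k) (d i (j ++ W)) (d j (j ++ W)))
    (trans (cong (seq (s k) n ℚ.*_) (at (plücker i j (j ++ W) k) n)) (ℚ.*-zeroʳ (seq (s k) n))))
    where
    eq₁ : ∀ a ij ik kj uk iu ju →
      ik ℚ.* kj ℚ.+ (a ℚ.* (ij ℚ.* uk)
        ℚ.+ (ik ℚ.* (a ℚ.* ju ℚ.+ (0ℚ ℚ.+ (ℚ.- 1ℚ) ℚ.* kj)) ℚ.+ a ℚ.* (iu ℚ.* kj)))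
      ≡ a ℚ.* (ij ℚ.* uk ℚ.+ iu ℚ.* kj ℚ.+ ik ℚ.* ju)
    eq₁ = solve 7 (λ a ij ik kj uk iu ju →
      ik :* kj :+ (a :* (ij :* uk) :+ (ik :* (a :* ju :+ (con 0ℚ ⊝ kj)) :+ a :* (iu :* kj)))
      := a :* (ij :* uk :+ iu :* kj :+ ik :* ju)) refl

  -- The Plücker relation for `i`, `j`, `y`, `y ++ Y`, signed so that in `i-before-j` the first term
  -- is positive and the others are nonnegative.
  between-identity : ∀ i j y Y →
    det i y ⊗ det (y ++ Y) j
      ⊕ (det i (y ++ Y) ⊗ (𝟎 ⊖ det y j) ⊕ det i j ⊗ det y Y) ≈ 𝟎
  between-identity i j y Y = pointwise λ n → let d = λ x z → seq (det x z) n in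
    trans (cong₂ (λ x z → d i y ℚ.* d (y ++ Y) j ℚ.+ (d i (y ++ Y) ℚ.* x ℚ.+ d i j ℚ.* z))
      (sym (at (det-anti j y) n)) (sym (at (det-absorbˡ y Y) n)))
    (trans (eq (d i y ℚ.* d (y ++ Y) j) (d i (y ++ Y) ℚ.* d j y) (d i j ℚ.* d y (y ++ Y)))
      (at (plücker i j y (y ++ Y)) n))
    where
    eq : ∀ p q r → p ℚ.+ (q ℚ.+ r) ≡ r ℚ.+ p ℚ.+ q
    eq = solve 3 (λ p q r → p :+ (q :+ r) := r :+ p :+ q) refl

  -- The Plücker relation for `i`, `j`, `Y ++ i`, `z`. Here `det i (Y ++ i)` is `s i ⊗ det i Y`, and
  -- the negative of `det i Y` is written as `det (j ++ Y) i ⊕ s Y ⊗ det i j`, whose signs are known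
  -- in `j-before-i`.
  outside-identity : ∀ i j Y z →
    det i z ⊗ det j (Y ++ i)
      ⊕ (det i j ⊗ det (Y ++ i) z
         ⊕ s i ⊗ ((det (j ++ Y) i ⊕ s Y ⊗ det i j) ⊗ (𝟎 ⊖ det z j))) ≈ 𝟎
  outside-identity i j Y z = pointwise λ n → let d = λ x z → seq (det x z) n in
    trans (cong (λ x → d i z ℚ.* d j (Y ++ i) ℚ.+ (d i j ℚ.* d (Y ++ i) z
        ℚ.+ seq (s i) n ℚ.* ((x ℚ.+ seq (s Y) n ℚ.* d i j) ℚ.* (0ℚ ℚ.+ (ℚ.- 1ℚ) ℚ.* d z j))))
      (trans (at (det-++ˡ j Y i) n)
        (cong₂ (λ x y → seq (s Y) n ℚ.* x ℚ.+ y) (at (det-anti j i) n) (at (det-anti Y i) n))))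
    (trans (eq₁ (seq (s i) n) (seq (s Y) n) (d i j) (d i Y) (d z j)
              (d i z ℚ.* d j (Y ++ i)) (d i j ℚ.* d (Y ++ i) z))
    (trans (cong (λ x → d i j ℚ.* d (Y ++ i) z ℚ.+ x ℚ.* d z j ℚ.+ d i z ℚ.* d j (Y ++ i))
        (trans (cong (λ x → seq (s i) n ℚ.* d i Y ℚ.+ x) (sym (at (det-self i) n)))
          (sym (at (det-++ʳ i Y i) n))))
    (at (plücker i j (Y ++ i) z) n)))
    where
    eq₁ : ∀ si sY ij iY zj p q →
      p ℚ.+ (q ℚ.+ si ℚ.* ((sY ℚ.* (0ℚ ℚ.+ (ℚ.- 1ℚ) ℚ.* ij) ℚ.+ (0ℚ ℚ.+ (ℚ.- 1ℚ) ℚ.* iY)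
        ℚ.+ sY ℚ.* ij) ℚ.* (0ℚ ℚ.+ (ℚ.- 1ℚ) ℚ.* zj)))
      ≡ q ℚ.+ (si ℚ.* iY ℚ.+ 0ℚ) ℚ.* zj ℚ.+ p
    eq₁ = solve 7 (λ si sY ij iY zj p q →
      p :+ (q :+ si :* ((sY :* (con 0ℚ ⊝ ij) :+ (con 0ℚ ⊝ iY) :+ sY :* ij) :* (con 0ℚ ⊝ zj)))
      := q :+ (si :* iY :+ con 0ℚ) :* zj :+ p) refl

  ⊗-congˡ : ∀ x {y z} → y ≈ z → x ⊗ y ≈ x ⊗ z
  ⊗-congˡ x y≈z = pointwise λ i → cong (seq x i ℚ.*_) (at y≈z i)

  -- If `s A` vanishes, `A` is constant with value `b A`, and `p` displaces this value by exactly
  -- `det p A`.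
  fixpoint-identity : ∀ p A → s p ⊗ b A ⊕ b p ≈ b A ⊕ (det p A ⊕ s A ⊗ b p)
  fixpoint-identity p A = pointwise λ i →
    eq (seq (s p) i) (seq (b p) i) (seq (s A) i) (seq (b A) i)
    where
    eq : ∀ sp bp sA bA → sp ℚ.* bA ℚ.+ bp ≡ bA ℚ.+
      (bp ℚ.* (1ℚ ℚ.+ (ℚ.- 1ℚ) ℚ.* sA) ℚ.+ (ℚ.- 1ℚ) ℚ.* (bA ℚ.* (1ℚ ℚ.+ (ℚ.- 1ℚ) ℚ.* sp)) ℚ.+ sA ℚ.* bp)
    eq = solve 4 (λ sp bp sA bA → sp :* bA :+ bp := bA :+
      (((bp :* (con 1ℚ ⊝ sA)) ⊝ (bA :* (con 1ℚ ⊝ sp))) :+ sA :* bp)) refl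

  -- The displacement f(x) - x of f(x) = s x + q is affine with slope s - 1.
  affine-identity : ∀ s q x y → s ⊗ y ⊕ q ⊖ y ≈ (s ⊗ x ⊕ q ⊖ x) ⊕ (𝟏 ⊖ s) ⊗ (x ⊖ y)
  affine-identity s q x y = pointwise λ i → eq (seq s i) (seq q i) (seq x i) (seq y i)
    where
    eq : ∀ s q x y → s ℚ.* y ℚ.+ q ℚ.+ (ℚ.- 1ℚ) ℚ.* y ≡ (s ℚ.* x ℚ.+ q ℚ.+ (ℚ.- 1ℚ) ℚ.* x)
      ℚ.+ (1ℚ ℚ.+ (ℚ.- 1ℚ) ℚ.* s) ℚ.* (x ℚ.+ (ℚ.- 1ℚ) ℚ.* y)
    eq = solve 4 (λ s q x y → (s :* y :+ q) ⊝ y := ((s :* x :+ q) ⊝ x) :+ (con 1ℚ ⊝ s) :* (x ⊝ y)) refl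

  [x⊖y]⊗[z⊖w]≈[y⊖x]⊗[w⊖z] : ∀ x y z w → (x ⊖ y) ⊗ (z ⊖ w) ≈ (y ⊖ x) ⊗ (w ⊖ z)
  [x⊖y]⊗[z⊖w]≈[y⊖x]⊗[w⊖z] x y z w = pointwise λ i → eq (seq x i) (seq y i) (seq z i) (seq w i)
    where
    eq : ∀ x y z w → (x ℚ.+ (ℚ.- 1ℚ) ℚ.* y) ℚ.* (z ℚ.+ (ℚ.- 1ℚ) ℚ.* w)
      ≡ (y ℚ.+ (ℚ.- 1ℚ) ℚ.* x) ℚ.* (w ℚ.+ (ℚ.- 1ℚ) ℚ.* z)
    eq = solve 4 (λ x y z w → (x ⊝ y) :* (z ⊝ w) := (y ⊝ x) :* (w ⊝ z)) refl

  ⊕-comm : ∀ x y → x ⊕ y ≈ y ⊕ x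
  ⊕-comm x y = pointwise λ i → ℚ.+-comm (seq x i) (seq y i)

  [𝟎⊖x]⊗[𝟎⊖y]≈x⊗y : ∀ x y → (𝟎 ⊖ x) ⊗ (𝟎 ⊖ y) ≈ x ⊗ y
  [𝟎⊖x]⊗[𝟎⊖y]≈x⊗y x y = pointwise λ i → eq (seq x i) (seq y i)
    where
    eq : ∀ x y → (0ℚ ℚ.+ (ℚ.- 1ℚ) ℚ.* x) ℚ.* (0ℚ ℚ.+ (ℚ.- 1ℚ) ℚ.* y) ≡ x ℚ.* y
    eq = solve 2 (λ x y → (con 0ℚ ⊝ x) :* (con 0ℚ ⊝ y) := x :* y) refl

≈-reflexive : ∀ {x y} → x ≡ y → x ≈ y
≈-reflexive refl = ≈-refl

-- Minimisation over the arrangements of a list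

insertions : ∀ {A : Set} → A → List A → List (List A)
insertions x []       = [ [ x ] ]
insertions x (y ∷ ys) = (x ∷ y ∷ ys) ∷ map (y ∷_) (insertions x ys)

permutations : ∀ {A : Set} → List A → List (List A)
permutations []       = [ [] ]
permutations (x ∷ xs) = concatMap (insertions x) (permutations xs)

module _ {A : Set} where

  insertions-sound : ∀ (x : A) xs {ys} → ys ∈ insertions x xs → ys ↭ x ∷ xs
  insertions-sound x []       (here refl) = ↭-refl
  insertions-sound x (y ∷ xs) (here refl) = ↭-refl
  insertions-sound x (y ∷ xs) (there h) with zs , zs∈ , refl ← ∈-map⁻ (y ∷_) h =
    ↭-trans (prep y (insertions-sound x xs zs∈)) (swap y x ↭-refl)

  insertions-complete : ∀ (x : A) xs ys → xs ++ x ∷ ys ∈ insertions x (xs ++ ys)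
  insertions-complete x []       []       = here refl
  insertions-complete x []       (y ∷ ys) = here refl
  insertions-complete x (y ∷ xs) ys       = there (∈-map⁺ (y ∷_) (insertions-complete x xs ys))

  permutations-sound : ∀ (xs : List A) {ys} → ys ∈ permutations xs → ys ↭ xs
  permutations-sound []       (here refl) = ↭-refl
  permutations-sound (x ∷ xs) h
    with zs , zs∈ , ys∈ ← find (∈-concatMap⁻ (insertions x) {xs = permutations xs} h) =
    ↭-trans (insertions-sound x zs ys∈) (prep x (permutations-sound xs zs∈))

  permutations-complete : ∀ (xs : List A) {ys} → ys ↭ xs → ys ∈ permutations xs
  permutations-complete [] {[]}    p = here refl
  permutations-complete [] {_ ∷ _} p with () ← ↭-length p
  permutations-complete (x ∷ xs) {ys} p
    with us , vs , refl ← ∈-∃++ (∈-resp-↭ (↭-sym p) (here refl)) =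
    ∈-concatMap⁺ (insertions x)
      (lose (permutations-complete xs (drop-mid us [] p)) (insertions-complete x us vs))

  -- The order on reals is not decidable, so the minimiser is handed to a continuation whose goal is
  -- an inequality.
  argmin : ∀ (φ : A → ℝ) x xs {u v} →
    (∀ m → m ∈ x ∷ xs → (∀ {y} → y ∈ x ∷ xs → φ m ≼ φ y) → u ≼ v) → u ≼ v
  argmin φ x []       k = k x (here refl) λ { (here refl) → ≼-refl }
  argmin φ x (y ∷ xs) k = argmin φ y xs λ m m∈ m-min →
    ≼-by-cases {φ x ≼ φ m}
      (λ x≤m → k x (here refl) λ
        { (here refl) → ≼-refl
        ; (there z∈)  → ≼-trans x≤m (m-min z∈) })
      (λ m<x → k m (there m∈) λ
        { (here refl) → ≺⇒≼ m<x
        ; (there z∈)  → m-min z∈ })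

-- Intercepts are enough for the comparison: rearranging does not change the slope of the composite.
IsMin : List LinearFunction → List LinearFunction → Set
IsMin σ ρ = ρ ↭ σ × (∀ τ → τ ↭ σ → b ρ ≼ b τ)

minimum-exists : ∀ σ {u v} → (∀ ρ → IsMin σ ρ → u ≼ v) → u ≼ v
-- `σ` itself is the seed that makes the list of candidates nonempty.
minimum-exists σ k = argmin b σ (permutations σ) λ
  { ρ (here refl) ρ-min → k ρ (↭-refl , λ τ p → ρ-min (there (permutations-complete σ p)))
  ; ρ (there ρ∈)  ρ-min → k ρ (permutations-sound σ ρ∈ , λ τ p → ρ-min (there (permutations-complete σ p))) }

-- Block swaps in lists of functions

NonnegativeSlope : LinearFunction → Set
NonnegativeSlope f = 𝟎 ≼ slope f

-- By b-swap, s Z ⊗ det A B is the increase caused by swapping A and B.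
LocallyOptimal : List LinearFunction → Set
LocallyOptimal σ = ∀ X A B Z → σ ≡ X ++ A ++ B ++ Z → 𝟎 ≼ s Z ⊗ det A B

0≼s : ∀ {σ} → All NonnegativeSlope σ → 𝟎 ≼ s σ
0≼s []        = ≺⇒≼ 𝟎≺s[]
0≼s {f ∷ σ} (a ∷ as) =
  0≼-resp-≈ (≈-sym (s-++ [ f ] σ)) (0≼x⊗y (0≼s as) (𝟎≼s[f] f a))

0≺s-suffix : ∀ {A B} → All NonnegativeSlope A → 𝟎 ≺ s (A ++ B) → 𝟎 ≺ s B
0≺s-suffix {A} {B} a 0<s = 0≺x⊗y⇒0≺x (0≼s a) (≺-resp-≈ (s-++ A B) 0<s)

swap-≼ : ∀ X A B Z → s Z ⊗ det A B ≼ 𝟎 → b (X ++ B ++ A ++ Z) ≼ b (X ++ A ++ B ++ Z)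
swap-≼ X A B Z gain≤0 = x≈y≼z⇒x≼z (b-swap X A B Z) (x⊕y≼x gain≤0)

swap-≽ : ∀ X A B Z → 𝟎 ≼ s Z ⊗ det A B → b (X ++ A ++ B ++ Z) ≼ b (X ++ B ++ A ++ Z)
swap-≽ X A B Z 0≤gain = x≼y≈z⇒x≼z (x≼x⊕y 0≤gain) (≈-sym (b-swap X A B Z))

≼-swap⇒0≼ : ∀ X A B Z → b (X ++ A ++ B ++ Z) ≼ b (X ++ B ++ A ++ Z) → 𝟎 ≼ s Z ⊗ det A B
≼-swap⇒0≼ X A B Z h = x≼x⊕y⇒0≼y (x≼y≈z⇒x≼z h (b-swap X A B Z))

swap-↭ : ∀ (X A B Z : List LinearFunction) → X ++ B ++ A ++ Z ↭ X ++ A ++ B ++ Z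
swap-↭ X A B Z = ++⁺ˡ X (shifts B A)

locallyOptimal-tail : ∀ {f σ} → LocallyOptimal (f ∷ σ) → LocallyOptimal σ
locallyOptimal-tail {f} lo X A B Z refl = lo (f ∷ X) A B Z refl

-- A swap in the merged list is a swap in `i ∷ j ∷ W` that keeps `i` and `j` in one block.
locallyOptimal-merge : ∀ {i j W} → LocallyOptimal (i ∷ j ∷ W) → LocallyOptimal ((i ⨾ j) ∷ W)
locallyOptimal-merge {i} {j} lo (_ ∷ X) A B Z refl = lo (i ∷ j ∷ X) A B Z refl
locallyOptimal-merge {i} {j} lo [] (_ ∷ A) B Z refl =
  0≼-resp-≈ (⊗-congˡ (s Z) (≈-sym (⨾-det i j A B))) (lo [] (i ∷ j ∷ A) B Z refl)
locallyOptimal-merge lo [] [] B Z _ = ≼-swap⇒0≼ [] [] B Z ≼-refl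

min⇒0≼ : ∀ {σ ρ} → IsMin σ ρ → ∀ X A B Z → ρ ≡ X ++ A ++ B ++ Z → 𝟎 ≼ s Z ⊗ det A B
min⇒0≼ (ρ↭σ , ρ-min) X A B Z refl =
  ≼-swap⇒0≼ X A B Z (ρ-min _ (↭-trans (swap-↭ X A B Z) ρ↭σ))

-- Lets a minimum arrangement be rearranged repeatedly without losing minimality.
min-swap : ∀ {σ ρ τ} → IsMin σ ρ → ∀ X A B Z → ρ ≡ X ++ A ++ B ++ Z → τ ≡ X ++ B ++ A ++ Z →
  s Z ⊗ det A B ≼ 𝟎 → b τ ≼ b ρ × IsMin σ τ
min-swap (ρ↭σ , ρ-min) X A B Z refl refl gain≤0 =
  swap-≼ X A B Z gain≤0 ,
  ↭-trans (swap-↭ X A B Z) ρ↭σ ,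
  λ τ p → ≼-trans (swap-≼ X A B Z gain≤0) (ρ-min τ p)

-- Vanishing slopes after the first function

-- Two inequalities instead of `_≈_`, which compares representatives.
Null : ℝ → Set
Null x = 𝟎 ≼ x × x ≼ 𝟎

null⇒⊗≼𝟎 : ∀ {x} → Null x → ∀ y → x ⊗ y ≼ 𝟎
null⇒⊗≼𝟎 (0≤x , x≤0) y = ≼-by-cases {𝟎 ≼ y} (x≼0⇒x⊗y≼0 x≤0) λ y<0 → y≼0⇒x⊗y≼0 0≤x (≺⇒≼ y<0)

null⇒𝟎≼⊗ : ∀ {x} → Null x → ∀ y → 𝟎 ≼ x ⊗ y
null⇒𝟎≼⊗ {x} (0≤x , x≤0) y = ≼-by-cases {𝟎 ≼ y} (0≼x⊗y 0≤x) λ y<0 →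
  0≼-resp-≈ ([𝟎⊖x]⊗[𝟎⊖y]≈x⊗y x y) (0≼x⊗y (x≼y⇒0≼y⊖x x≤0) (x≼y⇒0≼y⊖x (≺⇒≼ y<0)))

null-s : ∀ A {k B} → All NonnegativeSlope (A ++ k ∷ B) → s [ k ] ≼ 𝟎 → Null (s (A ++ k ∷ B))
null-s A {k} {B} nn sk≤0 with All.++⁻ʳ A nn
... | _ ∷ nnB = 0≼s nn , x≈y≼z⇒x≼z (s-++ A (k ∷ B)) (x≼0⇒x⊗y≼0
  (x≈y≼z⇒x≼z (s-++ [ k ] B) (y≼0⇒x⊗y≼0 (0≼s nnB) sk≤0)) (0≼s (All.++⁻ˡ A nn)))

null⇒b-++≼b : ∀ A B → Null (s B) → b (A ++ B) ≼ b B
null⇒b-++≼b A B s≃0 = x≈y≼z⇒x≼z (b-++ A B)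
  (x≈y≼z⇒x≼z (⊕-comm _ _) (x⊕y≼x (null⇒⊗≼𝟎 s≃0 (b A))))

null⇒b≼b-++ : ∀ A B → Null (s B) → b B ≼ b (A ++ B)
null⇒b≼b-++ A B s≃0 = x≼y≈z⇒x≼z (x≼x⊕y (null⇒𝟎≼⊗ s≃0 (b A)))
  (≈-trans (⊕-comm _ _) (≈-sym (b-++ A B)))

null⇒b≼apply : ∀ p A → Null (s A) → 𝟎 ≼ det p A → b A ≼ s p ⊗ b A ⊕ b p
null⇒b≼apply p A s≃0 0≤det = x≼y≈z⇒x≼z (x≼x⊕y (0≼x⊕y 0≤det (null⇒𝟎≼⊗ s≃0 (b p))))
  (≈-sym (fixpoint-identity p A))

-- An affine displacement that is nonnegative at both ends is nonnegative in between. It is compared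
-- with its value at the end towards which it decreases: `z` if a ≤ 1, otherwise `x`.
apply-between : ∀ {a q x y z} → x ≼ y → y ≼ z → x ≼ a ⊗ x ⊕ q → z ≼ a ⊗ z ⊕ q → y ≼ a ⊗ y ⊕ q
apply-between {a} {q} {x} {y} {z} x≤y y≤z x≤fx z≤fz = ≼-by-cases {a ≼ 𝟏}
  (λ a≤1 → 0≼y⊖x⇒x≼y (0≼-resp-≈ (≈-sym (affine-identity a q z y))
    (0≼x⊕y (x≼y⇒0≼y⊖x z≤fz) (0≼x⊗y (x≼y⇒0≼y⊖x a≤1) (x≼y⇒0≼y⊖x y≤z)))))
  (λ 1<a → 0≼y⊖x⇒x≼y (0≼-resp-≈ (≈-sym (affine-identity a q x y))
    (0≼x⊕y (x≼y⇒0≼y⊖x x≤fx)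
      (0≼-resp-≈ ([x⊖y]⊗[z⊖w]≈[y⊖x]⊗[w⊖z] a 𝟏 y x)
        (0≼x⊗y (x≼y⇒0≼y⊖x (≺⇒≼ 1<a)) (x≼y⇒0≼y⊖x x≤y))))))

b-++-mono : ∀ B {x y} → 𝟎 ≼ s B → x ≼ y → s B ⊗ x ⊕ b B ≼ s B ⊗ y ⊕ b B
b-++-mono B 0≤s x≤y = ⊕-mono-≼ (⊗-monoʳ-≼ 0≤s x≤y) ≼-refl

Optimal : List LinearFunction → Set
Optimal σ = ∀ ρ → ρ ↭ σ → b σ ≼ b ρ

null-case : ∀ p Q k T → let σ = Q ++ k ∷ T in
  All NonnegativeSlope (p ∷ σ) → s [ k ] ≼ 𝟎 → 𝟎 ≺ s T →
  LocallyOptimal (p ∷ σ) → Optimal σ → Optimal (p ∷ σ)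
null-case p Q k T (nn-p ∷ nn) sk≤0 0<sT lo opt ρ ρ↭
  with X , Y , refl ← ∈-∃++ (∈-resp-↭ (↭-sym ρ↭) (here refl)) =
  ≼-trans (null⇒b-++≼b [ p ] σ σ-null) (by-place (∈-++⁻ X k∈XY))
  where
  σ = Q ++ k ∷ T

  XY↭σ : X ++ Y ↭ σ
  XY↭σ = drop-mid X [] ρ↭

  k∈XY : k ∈ X ++ Y
  k∈XY = ∈-resp-↭ (↭-sym XY↭σ) (∈-insert Q)

  nnXY : All NonnegativeSlope (X ++ Y)
  nnXY = All-resp-↭ (↭-sym XY↭σ) nn

  nnX = All.++⁻ˡ X nnXY
  nnY = All.++⁻ʳ X nnXY

  σ-null : Null (s σ)
  σ-null = null-s Q nn sk≤0

  -- This is the constant value of `k`, whose slope vanishes.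
  c = b (Q ++ [ k ])

  c-fixed : c ≼ s [ p ] ⊗ c ⊕ b [ p ]
  c-fixed = null⇒b≼apply [ p ] (Q ++ [ k ])
    (null-s Q (All.++⁻ˡ (Q ++ [ k ]) (subst (All NonnegativeSlope) (sym (++-assoc Q [ k ] T)) nn)) sk≤0)
    (0≼-cancelˡ 0<sT (lo [] [ p ] (Q ++ [ k ]) T (cong (p ∷_) (sym (++-assoc Q [ k ] T)))))

  bσ-fixed : b σ ≼ s [ p ] ⊗ b σ ⊕ b [ p ]
  bσ-fixed = null⇒b≼apply [ p ] σ σ-null
    (0≼-cancelˡ 𝟎≺s[] (lo [] [ p ] σ [] (cong (p ∷_) (sym (++-identityʳ σ)))))

  through : ∀ {x} → x ≼ s [ p ] ⊗ b X ⊕ b [ p ] → s Y ⊗ x ⊕ b Y ≼ b (X ++ p ∷ Y)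
  through x≤ = ≼-trans (b-++-mono Y (0≼s nnY)
      (x≼y≈z⇒x≼z x≤ (≈-sym (b-++ X [ p ]))))
    (≈⇒≼ (≈-trans (≈-sym (b-++ (X ++ [ p ]) Y)) (≈-reflexive (cong b (++-assoc X [ p ] Y)))))

  by-place : k ∈ X ⊎ k ∈ Y → b σ ≼ b (X ++ p ∷ Y)
  -- A later `k` erases the effect of everything before it, including `p`.
  by-place (inj₂ k∈Y) with Y₁ , Y₂ , refl ← ∈-∃++ k∈Y =
    ≼-trans (opt (X ++ Y) XY↭σ) (≼-trans (null⇒b-++≼b X Y Y-null)
      (x≼y≈z⇒x≼z (null⇒b≼b-++ (X ++ [ p ]) Y Y-null) (≈-reflexive (cong b (++-assoc X [ p ] Y)))))
    where
    Y-null = null-s Y₁ nnY sk≤0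
  by-place (inj₁ k∈X) with X₁ , X₂ , refl ← ∈-∃++ k∈X = ≼-by-cases {b X ≼ c}
    -- Now `b X` lies between `b σ` and `c`, so `p` does not lower it before `Y` is applied.
    (λ bX≤c → ≼-trans (opt (X ++ Y) XY↭σ) (x≈y≼z⇒x≼z (b-++ X Y)
      (through (apply-between bσ≤bX bX≤c bσ-fixed c-fixed))))
    -- Moving `k` to the end of `X` feeds at most `c` to `Y`, while `p` sends `b X` to at least p(c)
    -- ≥ c.
    (λ c<bX → ≼-trans (opt (R ++ Y) R↭σ) (x≈y≼z⇒x≼z (b-++ R Y)
      (≼-trans (b-++-mono Y (0≼s nnY) bR≤c)
        (through (≼-trans c-fixed (⊕-mono-≼ (⊗-monoʳ-≼ (𝟎≼s[f] p nn-p) (≺⇒≼ c<bX)) ≼-refl))))))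
    where
    R = (X₁ ++ X₂) ++ [ k ]

    R↭σ : R ++ Y ↭ σ
    R↭σ = ↭-trans (↭-reflexive (trans (++-assoc (X₁ ++ X₂) [ k ] Y) (++-assoc X₁ X₂ (k ∷ Y))))
      (↭-trans (++⁺ˡ X₁ (shift k X₂ Y))
      (↭-trans (↭-reflexive (sym (++-assoc X₁ (k ∷ X₂) Y))) XY↭σ))

    k-null : Null (s [ k ])
    k-null = null-s [] (All.head (All.++⁻ʳ Q nn) ∷ []) sk≤0

    bR≤c : b R ≼ c
    bR≤c = ≼-trans (null⇒b-++≼b (X₁ ++ X₂) [ k ] k-null) (null⇒b≼b-++ Q [ k ] k-null)

    X-null : Null (s (X₁ ++ k ∷ X₂))
    X-null = null-s X₁ nnX sk≤0

    bσ≤bX : b σ ≼ b (X₁ ++ k ∷ X₂)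
    -- `Y ++ X` also arranges `σ`, and its value is the constant value of `X`.
    bσ≤bX = ≼-trans (opt (Y ++ X) (↭-trans (++-comm Y X) XY↭σ)) (null⇒b-++≼b Y X X-null)

-- The tail is searched before the head is examined, so the function found is the last one with
-- vanishing slope.
last-null : ∀ {u v} σ → All NonnegativeSlope σ →
  (𝟎 ≺ s σ → u ≼ v) →
  (∀ Q k T → σ ≡ Q ++ k ∷ T → s [ k ] ≼ 𝟎 → 𝟎 ≺ s T → u ≼ v) → u ≼ v
last-null []      []       pos null = pos 𝟎≺s[]
last-null (f ∷ σ) (_ ∷ nn) pos null = last-null σ nn
  (λ 0<sσ → ≼-by-cases {s [ f ] ≼ 𝟎}
    (λ sf≤0 → null [] f σ refl sf≤0 0<sσ)
    (λ 0<sf → pos (≺-resp-≈ (≈-sym (s-++ [ f ] σ)) (0≺x⊗y 0<sσ 0<sf))))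
  (λ { Q k T refl → null (f ∷ Q) k T refl })

-- Gluing the first two functions

-- If `det i j` is positive, this puts the vector of `k` strictly inside the cone spanned by those
-- of `i` and `j`.
Between : List LinearFunction → List LinearFunction → LinearFunction → Set
Between i j k = 𝟎 ≺ det i [ k ] × 𝟎 ≺ det [ k ] j

-- For `k` in `W`, betweenness would make the first term of `cone-identity` positive, while local
-- optimality makes the remaining ones nonnegative.
nothing-between : ∀ {i j W} → All NonnegativeSlope (i ∷ j ∷ W) → LocallyOptimal (i ∷ j ∷ W) →
  𝟎 ≺ s (j ∷ W) → All (λ k → ¬ Between [ i ] [ j ] k) (i ∷ j ∷ W)
nothing-between {i} {j} {W} (nn-i ∷ nn-j ∷ nn) lo 0<s =
  (λ (p , _) → p (≈⇒≼ (det-self [ i ]))) ∷ (λ (_ , q) → q (≈⇒≼ (det-self [ j ]))) ∷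
  All.tabulate λ k∈W → in-W (∈-∃++ k∈W)
  where
  0<sW : 𝟎 ≺ s W
  0<sW = 0≺s-suffix {[ j ]} (nn-j ∷ []) 0<s

  in-W : ∀ {k} → (∃ λ W₁ → ∃ λ W₂ → W ≡ W₁ ++ [ k ] ++ W₂) → ¬ Between [ i ] [ j ] k
  in-W {k} (W₁ , W₂ , refl) (0<ik , 0<kj) = 0≺-sum-≉𝟎
    (0≼x⊕y (0≼x⊗y 0≤sk (0≼x⊗y 0≤ij 0≤jW₁,k))
      (0≼x⊕y (0≼x⊗y (≺⇒≼ 0<ik) 0≤j,W₁k) (0≼x⊗y 0≤sk (0≼x⊗y 0≤i,jW₁ (≺⇒≼ 0<kj)))))
    (0≺x⊗y 0<ik 0<kj)
    (cone-identity [ i ] [ j ] W₁ [ k ])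
    where
    nn-kW₂ = All.++⁻ʳ W₁ nn
    0<skW₂ : 𝟎 ≺ s (k ∷ W₂)
    0<skW₂ = 0≺s-suffix {W₁} (All.++⁻ˡ W₁ nn) 0<sW
    0<sW₂ : 𝟎 ≺ s W₂
    0<sW₂ = 0≺s-suffix {[ k ]} (All.head nn-kW₂ ∷ []) 0<skW₂
    0≤sk   = 𝟎≼s[f] k (All.head nn-kW₂)
    0≤ij   = 0≼-cancelˡ 0<sW (lo [] [ i ] [ j ] W refl)
    0≤i,jW₁ = 0≼-cancelˡ 0<skW₂ (lo [] [ i ] (j ∷ W₁) (k ∷ W₂) refl)
    0≤jW₁,k = 0≼-cancelˡ 0<sW₂ (lo [ i ] (j ∷ W₁) [ k ] W₂ refl)
    0≤j,W₁k = 0≼-cancelˡ 0<sW₂ (lo [ i ] [ j ] (W₁ ++ [ k ]) W₂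
      (cong (λ A → i ∷ j ∷ A) (sym (++-assoc W₁ [ k ] W₂))))

-- `β` bounds from below all arrangements in which `i` stands directly in front of `j` or at the
-- end. Every minimum arrangement is brought into one of these forms by swaps of nonpositive cost,
-- hence obeys the same bound.
module Glue {σ i j β}
  (nn : All NonnegativeSlope σ)
  (0≤ij : 𝟎 ≼ det [ i ] [ j ])
  (none-between : All (λ k → ¬ Between [ i ] [ j ] k) σ)
  (glued : ∀ X Z → X ++ i ∷ j ∷ Z ↭ σ → β ≼ b (X ++ i ∷ j ∷ Z))
  (last  : ∀ X → X ++ [ i ] ↭ σ → β ≼ b (X ++ [ i ]))
  where

  glued′ : ∀ X Z {ρ τ} → τ ≡ X ++ i ∷ j ∷ Z → b τ ≼ b ρ × IsMin σ τ → β ≼ b ρ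
  glued′ X Z refl (bτ≤bρ , τ↭σ , _) = ≼-trans (glued X Z τ↭σ) bτ≤bρ

  0≼s-suffix : ∀ A {B} → A ++ B ↭ σ → 𝟎 ≼ s B
  0≼s-suffix A p = 0≼s (All.++⁻ʳ A (All-resp-↭ (↭-sym p) nn))

  ¬between : ∀ A {k B} → A ++ k ∷ B ↭ σ → ¬ Between [ i ] [ j ] k
  ¬between A p = All.head (All.++⁻ʳ A (All-resp-↭ (↭-sym p) none-between))

  -- Three swaps are tried: `i` past `y ∷ Y`, `j` in front of `y ∷ Y`, and `i` past `y` alone, after
  -- which `Y` is shorter. If each of them has positive cost, `between-identity` is violated.
  i-before-j : ∀ X Y Z → IsMin σ (X ++ i ∷ Y ++ j ∷ Z) → β ≼ b (X ++ i ∷ Y ++ j ∷ Z)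
  i-before-j X []      Z (ρ↭σ , _) = glued X Z ρ↭σ
  i-before-j X (y ∷ Y) Z ρ-min@(ρ↭σ , _) =
    ≼-by-cases {s (j ∷ Z) ⊗ det [ i ] (y ∷ Y) ≼ 𝟎}
      (λ gain≤0 → glued′ (X ++ y ∷ Y) Z (sym (++-assoc X (y ∷ Y) _))
        (min-swap ρ-min X [ i ] (y ∷ Y) (j ∷ Z) refl refl gain≤0)) λ 0<iY →
    ≼-by-cases {s Z ⊗ det (y ∷ Y) [ j ] ≼ 𝟎}
      (λ gain≤0 → glued′ X (y ∷ Y ++ Z) (++-assoc X [ i ] _)
        (min-swap ρ-min (X ++ [ i ]) (y ∷ Y) [ j ] Z (sym (++-assoc X [ i ] _)) refl gain≤0)) λ 0<Yj →
    ≼-by-cases {s (Y ++ j ∷ Z) ⊗ det [ i ] [ y ] ≼ 𝟎}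
      (λ gain≤0 → let bτ≤bρ , τ-min = min-swap ρ-min X [ i ] [ y ] (Y ++ j ∷ Z)
                                        refl (++-assoc X [ y ] _) gain≤0
                  in ≼-trans (i-before-j (X ++ [ y ]) Y Z τ-min) bτ≤bρ) λ 0<iy →
    contradiction
      (between-identity [ i ] [ j ] [ y ] Y)
      (absurd 0<iY 0<Yj 0<iy)
    where
    0≤sjZ : 𝟎 ≼ s (j ∷ Z)
    0≤sjZ = 0≼s-suffix (X ++ i ∷ y ∷ Y) (↭-trans (↭-reflexive (++-assoc X (i ∷ y ∷ Y) (j ∷ Z))) ρ↭σ)
    0≤sZ : 𝟎 ≼ s Z
    0≤sZ = 0≼s-suffix ((X ++ i ∷ y ∷ Y) ++ [ j ]) (↭-trans (↭-reflexive
      (trans (++-assoc (X ++ i ∷ y ∷ Y) [ j ] Z) (++-assoc X (i ∷ y ∷ Y) (j ∷ Z)))) ρ↭σ)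
    0≤sYjZ : 𝟎 ≼ s (Y ++ j ∷ Z)
    0≤sYjZ = 0≼s-suffix (X ++ i ∷ [ y ]) (↭-trans (↭-reflexive (++-assoc X (i ∷ [ y ]) _)) ρ↭σ)
    not-between : ¬ Between [ i ] [ j ] y
    not-between = ¬between (X ++ [ i ]) (↭-trans (↭-reflexive (++-assoc X [ i ] _)) ρ↭σ)
    absurd : 𝟎 ≺ s (j ∷ Z) ⊗ det [ i ] (y ∷ Y) → 𝟎 ≺ s Z ⊗ det (y ∷ Y) [ j ] →
      𝟎 ≺ s (Y ++ j ∷ Z) ⊗ det [ i ] [ y ] →
      ¬ det [ i ] [ y ] ⊗ det (y ∷ Y) [ j ]
        ⊕ (det [ i ] (y ∷ Y) ⊗ (𝟎 ⊖ det [ y ] [ j ]) ⊕ det [ i ] [ j ] ⊗ det [ y ] Y) ≈ 𝟎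
    absurd 0<iY 0<Yj 0<iy = 0≺-sum-≉𝟎
      (0≼x⊕y
        (0≼x⊗y (≺⇒≼ (0≺x⊗y⇒0≺y 0≤sjZ 0<iY))
          (x≼y⇒0≼y⊖x (≼-stable λ 0<yj → not-between (0<iy′ , 0<yj))))
        -- `s (j ∷ Z)` is positive because it is a nonnegative factor of a positive product.
        (0≼x⊗y 0≤ij (0≼-cancelˡ (λ sjZ≤0 → 0<iY (sjZ≤0⇒ sjZ≤0))
          (min⇒0≼ ρ-min (X ++ [ i ]) [ y ] Y (j ∷ Z) (sym (++-assoc X [ i ] _))))))
      (0≺x⊗y 0<iy′ (0≺x⊗y⇒0≺y 0≤sZ 0<Yj))
      where
      0<iy′ = 0≺x⊗y⇒0≺y 0≤sYjZ 0<iy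
      sjZ≤0⇒ : s (j ∷ Z) ≼ 𝟎 → s (j ∷ Z) ⊗ det [ i ] (y ∷ Y) ≼ 𝟎
      sjZ≤0⇒ sjZ≤0 = null⇒⊗≼𝟎 (0≤sjZ , sjZ≤0) _

  -- Here the swaps are: `i` in front of `j ∷ Y`, `j` behind `Y ++ [ i ]`, and `i` past `z`, which
  -- repeats until `i` is last. If each has positive cost, `outside-identity` is violated.
  j-before-i : ∀ X Y Z → IsMin σ (X ++ j ∷ Y ++ i ∷ Z) → β ≼ b (X ++ j ∷ Y ++ i ∷ Z)
  j-before-i X Y [] (ρ↭σ , _) = x≼y≈z⇒x≼z
    (last (X ++ j ∷ Y) (↭-trans (↭-reflexive eq) ρ↭σ)) (≈-reflexive (cong b eq))
    where
    eq = ++-assoc X (j ∷ Y) [ i ]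
  j-before-i X Y (z ∷ Z) ρ-min@(ρ↭σ , _) =
    ≼-by-cases {s (z ∷ Z) ⊗ det (j ∷ Y) [ i ] ≼ 𝟎}
      (λ gain≤0 → glued′ X (Y ++ z ∷ Z) refl
        (min-swap ρ-min X (j ∷ Y) [ i ] (z ∷ Z) refl refl gain≤0)) λ 0<jY,i →
    ≼-by-cases {s (z ∷ Z) ⊗ det [ j ] (Y ++ [ i ]) ≼ 𝟎}
      (λ gain≤0 → glued′ (X ++ Y) (z ∷ Z)
        (trans (cong (X ++_) (++-assoc Y [ i ] _)) (sym (++-assoc X Y _)))
        (min-swap ρ-min X [ j ] (Y ++ [ i ]) (z ∷ Z)
          (cong (λ A → X ++ j ∷ A) (sym (++-assoc Y [ i ] _))) refl gain≤0)) λ 0<j,Yi →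
    ≼-by-cases {s Z ⊗ det [ i ] [ z ] ≼ 𝟎}
      (λ gain≤0 → let bτ≤bρ , τ-min = min-swap {τ = X ++ j ∷ (Y ++ [ z ]) ++ i ∷ Z} ρ-min
                                        (X ++ j ∷ Y) [ i ] [ z ] Z
                                        (sym (++-assoc X (j ∷ Y) _))
                                        (trans (cong (λ A → X ++ j ∷ A) (++-assoc Y [ z ] _))
                                          (sym (++-assoc X (j ∷ Y) _))) gain≤0
                  in ≼-trans (j-before-i X (Y ++ [ z ]) Z τ-min) bτ≤bρ) λ 0<iz →
    contradiction (outside-identity [ i ] [ j ] Y [ z ]) (absurd 0<jY,i 0<j,Yi 0<iz)
    where
    assoc : ∀ A → (X ++ j ∷ Y) ++ A ≡ X ++ j ∷ Y ++ A
    assoc = ++-assoc X (j ∷ Y)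
    all-nn : All NonnegativeSlope (X ++ j ∷ Y ++ i ∷ z ∷ Z)
    all-nn = All-resp-↭ (↭-sym ρ↭σ) nn
    nn-Y,iz : All NonnegativeSlope (Y ++ i ∷ z ∷ Z)
    nn-Y,iz with _ ∷ nn′ ← All.++⁻ʳ X all-nn = nn′
    nn-iz : All NonnegativeSlope (i ∷ z ∷ Z)
    nn-iz = All.++⁻ʳ Y nn-Y,iz
    not-between : ¬ Between [ i ] [ j ] z
    not-between = ¬between ((X ++ j ∷ Y) ++ [ i ])
      (↭-trans (↭-reflexive (trans (++-assoc (X ++ j ∷ Y) [ i ] _) (assoc _))) ρ↭σ)
    absurd : 𝟎 ≺ s (z ∷ Z) ⊗ det (j ∷ Y) [ i ] → 𝟎 ≺ s (z ∷ Z) ⊗ det [ j ] (Y ++ [ i ]) →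
      𝟎 ≺ s Z ⊗ det [ i ] [ z ] →
      ¬ det [ i ] [ z ] ⊗ det [ j ] (Y ++ [ i ])
        ⊕ (det [ i ] [ j ] ⊗ det (Y ++ [ i ]) [ z ]
           ⊕ s [ i ] ⊗ ((det (j ∷ Y) [ i ] ⊕ s Y ⊗ det [ i ] [ j ]) ⊗ (𝟎 ⊖ det [ z ] [ j ]))) ≈ 𝟎
    absurd 0<jY,i 0<j,Yi 0<iz with nn-i ∷ nn-z ∷ nn-Z ← nn-iz = 0≺-sum-≉𝟎
      (0≼x⊕y
        (0≼x⊗y 0≤ij (0≼-cancelˡ 0<sZ (min⇒0≼ ρ-min (X ++ [ j ]) (Y ++ [ i ]) [ z ] Z
          (trans (cong (λ A → X ++ j ∷ A) (sym (++-assoc Y [ i ] _))) (sym (++-assoc X [ j ] _))))))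
        (0≼x⊗y (𝟎≼s[f] i nn-i) (0≼x⊗y
          (0≼x⊕y (≺⇒≼ (0≺x⊗y⇒0≺y 0≤szZ 0<jY,i)) (0≼x⊗y (0≼s (All.++⁻ˡ Y nn-Y,iz)) 0≤ij))
          (x≼y⇒0≼y⊖x (≼-stable λ 0<zj → not-between (0<iz′ , 0<zj))))))
      (0≺x⊗y 0<iz′ (0≺x⊗y⇒0≺y 0≤szZ 0<j,Yi))
      where
      0≤szZ = 0≼s (nn-z ∷ nn-Z)
      0<iz′ = 0≺x⊗y⇒0≺y (0≼s nn-Z) 0<iz
      0<sZ : 𝟎 ≺ s Z
      0<sZ sZ≤0 = 0<iz (null⇒⊗≼𝟎 (0≼s nn-Z , sZ≤0) _)

positive-case : ∀ i j W → let σ = i ∷ j ∷ W in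
  All NonnegativeSlope σ → 𝟎 ≺ s (j ∷ W) → LocallyOptimal σ →
  Optimal (j ∷ W) → Optimal ((i ⨾ j) ∷ W) → Optimal σ
positive-case i j W nn@(nn-i ∷ nn-j ∷ nn-W) 0<s lo opt-tail opt-merged τ τ↭σ =
  minimum-exists σ λ ρ ρ-min@(ρ↭σ , ρ≤) → ≼-trans (below ρ ρ-min) (ρ≤ τ τ↭σ)
  where
  σ = i ∷ j ∷ W

  glued : ∀ X Z → X ++ i ∷ j ∷ Z ↭ σ → b σ ≼ b (X ++ i ∷ j ∷ Z)
  glued X Z p = x≈y≼z⇒x≼z (≈-sym (⨾-b i j W []))
    (x≼y≈z⇒x≼z (opt-merged (X ++ (i ⨾ j) ∷ Z)
        (↭-trans (shift (i ⨾ j) X Z) (prep (i ⨾ j) (drop-mid X [] (drop-mid X [] p)))))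
      (⨾-b i j Z X))

  -- Local optimality bounds `b σ` by the value of `(j ∷ W) ++ [ i ]`; optimality of `j ∷ W` and
  -- monotonicity of `i` do the rest.
  last : ∀ X → X ++ [ i ] ↭ σ → b σ ≼ b (X ++ [ i ])
  last X p = subst (λ ρ → b ρ ≼ b (X ++ [ i ])) (cong (i ∷_) (++-identityʳ (j ∷ W)))
    (≼-trans (swap-≽ [] [ i ] (j ∷ W) [] (lo [] [ i ] (j ∷ W) [] (cong (i ∷_) (sym (++-identityʳ (j ∷ W))))))
      (x≈y≼z⇒x≼z (b-++ (j ∷ W) [ i ])
        (x≼y≈z⇒x≼z (b-++-mono [ i ] (𝟎≼s[f] i nn-i) (opt-tail X X↭)) (≈-sym (b-++ X [ i ])))))
    where
    X↭ : X ↭ j ∷ W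
    X↭ = subst (_↭ j ∷ W) (++-identityʳ X) (drop-mid X [] p)

  0≤ij : 𝟎 ≼ det [ i ] [ j ]
  0≤ij = 0≼-cancelˡ (0≺s-suffix {[ j ]} (nn-j ∷ []) 0<s) (lo [] [ i ] [ j ] W refl)

  open Glue nn 0≤ij (nothing-between nn lo 0<s) glued last

  below : ∀ ρ → IsMin σ ρ → b σ ≼ b ρ
  below ρ ρ-min@(ρ↭σ , _)
    with X , R , refl ← ∈-∃++ (∈-resp-↭ (↭-sym ρ↭σ) (here {x = i} {xs = j ∷ W} refl))
    with ∈-++⁻ X (∈-resp-↭ (↭-sym (drop-mid X [] ρ↭σ)) (here {x = j} {xs = W} refl))
  ... | inj₂ j∈R with Y , Z , refl ← ∈-∃++ j∈R = i-before-j X Y Z ρ-min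
  ... | inj₁ j∈X with U , Y , refl ← ∈-∃++ j∈X =
    subst (λ ρ → b σ ≼ b ρ) (sym (++-assoc U (j ∷ Y) (i ∷ R)))
      (j-before-i U Y R (subst (IsMin σ) (++-assoc U (j ∷ Y) (i ∷ R)) ρ-min))

-- Induction on the number of functions

⨾-nonnegative : ∀ {f g} → NonnegativeSlope f → NonnegativeSlope g → NonnegativeSlope (f ⨾ g)
⨾-nonnegative nn-f nn-g = 0≼x⊗y nn-g nn-f

-- The length is an explicit argument because the induction also passes to `(f ⨾ j) ∷ W`, which is
-- not a subterm of the list.
locallyOptimal⇒optimal : ∀ n σ → length σ ≡ n → All NonnegativeSlope σ → LocallyOptimal σ → Optimal σ
locallyOptimal⇒optimal zero    []      refl _  _  ρ p with refl ← ↭-empty-inv p = ≼-refl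
locallyOptimal⇒optimal (suc n) (f ∷ σ) eq nn@(_ ∷ nn-σ) lo ρ p = last-null σ nn-σ
  (λ 0<s → positive σ (ℕ.suc-injective eq) 0<s nn lo opt ρ p)
  (λ { Q k T refl sk≤0 0<sT → null-case f Q k T nn sk≤0 0<sT lo opt ρ p })
  where
  opt = locallyOptimal⇒optimal n σ (ℕ.suc-injective eq) nn-σ (locallyOptimal-tail lo)
  positive : ∀ τ → length τ ≡ n → 𝟎 ≺ s τ → All NonnegativeSlope (f ∷ τ) → LocallyOptimal (f ∷ τ) →
    Optimal τ → Optimal (f ∷ τ)
  positive []      _  _   _  _  _   ρ p with refl ← ↭-singleton-inv p = ≼-refl
  positive (j ∷ W) eq 0<s nn@(nn-f ∷ nn-j ∷ nn-W) lo opt = positive-case f j W nn 0<s lo opt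
    (locallyOptimal⇒optimal n ((f ⨾ j) ∷ W) eq (⨾-nonnegative {f} {j} nn-f nn-j ∷ nn-W) (locallyOptimal-merge lo))

-- From permutations to lists

-- Total on natural numbers, so that `swapIndex` composes with it without bounds.
entry : ∀ {A : Set} → List A → ℕ → Maybe A
entry []       _       = nothing
entry (x ∷ xs) zero    = just x
entry (x ∷ xs) (suc i) = entry xs i

module _ {A : Set} where

  entry-++ˡ : ∀ (xs ys : List A) {i} → i ℕ.< length xs → entry (xs ++ ys) i ≡ entry xs i
  entry-++ˡ (x ∷ xs) ys {zero}  _         = refl
  entry-++ˡ (x ∷ xs) ys {suc i} (ℕ.s≤s h) = entry-++ˡ xs ys h

  entry-++ʳ : ∀ (xs ys : List A) i → entry (xs ++ ys) (length xs ℕ.+ i) ≡ entry ys i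
  entry-++ʳ []       ys i = refl
  entry-++ʳ (x ∷ xs) ys i = entry-++ʳ xs ys i

  entry-tabulate : ∀ {n} (h : Fin n → A) i → entry (tabulate h) (toℕ i) ≡ just (h i)
  entry-tabulate h zero    = refl
  entry-tabulate h (suc i) = entry-tabulate (h ∘ suc) i

  tabulate-unique : ∀ {n} (h : Fin n → A) xs → length xs ≡ n →
    (∀ i → entry xs (toℕ i) ≡ just (h i)) → tabulate h ≡ xs
  tabulate-unique {zero}  h []       eq   hyp = refl
  tabulate-unique {suc n} h (x ∷ xs) eq hyp =
    cong₂ _∷_ (sym (just-injective (hyp zero))) (tabulate-unique (h ∘ suc) xs (ℕ.suc-injective eq) (hyp ∘ suc))

  entry-swapIndex : ∀ X (a : A) P (c : A) Q Z i →
    let ℓ = length X ; p = length P ; q = length Q in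
    entry (X ++ (c ∷ Q) ++ (a ∷ P) ++ Z) i ≡
    entry (X ++ (a ∷ P) ++ (c ∷ Q) ++ Z) (swapIndex ℓ (ℓ ℕ.+ p) (suc (ℓ ℕ.+ p ℕ.+ q)) i)
  entry-swapIndex X a P c Q Z i with position (length X) (length P) (length Q) i
  ... | before h rewrite swap-before (length X) (length P) (length Q) h =
    trans (entry-++ˡ X _ h) (sym (entry-++ˡ X _ h))
  ... | left {j} h rewrite swap-left (length X) (length P) (length Q) h = begin
    entry (X ++ (c ∷ Q) ++ (a ∷ P) ++ Z) (length X ℕ.+ j)
      ≡⟨ entry-++ʳ X _ j ⟩
    entry ((c ∷ Q) ++ (a ∷ P) ++ Z) j
      ≡⟨ entry-++ˡ (c ∷ Q) _ (ℕ.s≤s h) ⟩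
    entry (c ∷ Q) j
      ≡⟨ entry-++ˡ (c ∷ Q) Z (ℕ.s≤s h) ⟨
    entry ((c ∷ Q) ++ Z) j
      ≡⟨ entry-++ʳ (a ∷ P) _ j ⟨
    entry ((a ∷ P) ++ (c ∷ Q) ++ Z) (suc (length P) ℕ.+ j)
      ≡⟨ entry-++ʳ X _ _ ⟨
    entry (X ++ (a ∷ P) ++ (c ∷ Q) ++ Z) (length X ℕ.+ (suc (length P) ℕ.+ j))
      ≡⟨ cong (entry (X ++ (a ∷ P) ++ (c ∷ Q) ++ Z)) (ℕ.+-assoc (length X) _ j) ⟨
    entry (X ++ (a ∷ P) ++ (c ∷ Q) ++ Z) (length X ℕ.+ suc (length P) ℕ.+ j) ∎
    where open ≡-Reasoning
  ... | right {k} h rewrite swap-right (length X) (length P) (length Q) h = begin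
    entry (X ++ (c ∷ Q) ++ (a ∷ P) ++ Z) (length X ℕ.+ suc (length Q) ℕ.+ k)
      ≡⟨ cong (entry (X ++ (c ∷ Q) ++ (a ∷ P) ++ Z)) (ℕ.+-assoc (length X) _ k) ⟩
    entry (X ++ (c ∷ Q) ++ (a ∷ P) ++ Z) (length X ℕ.+ (suc (length Q) ℕ.+ k))
      ≡⟨ entry-++ʳ X _ _ ⟩
    entry ((c ∷ Q) ++ (a ∷ P) ++ Z) (suc (length Q) ℕ.+ k)
      ≡⟨ entry-++ʳ (c ∷ Q) _ k ⟩
    entry ((a ∷ P) ++ Z) k
      ≡⟨ entry-++ˡ (a ∷ P) Z (ℕ.s≤s h) ⟩
    entry (a ∷ P) k
      ≡⟨ entry-++ˡ (a ∷ P) _ (ℕ.s≤s h) ⟨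
    entry ((a ∷ P) ++ (c ∷ Q) ++ Z) k
      ≡⟨ entry-++ʳ X _ k ⟨
    entry (X ++ (a ∷ P) ++ (c ∷ Q) ++ Z) (length X ℕ.+ k) ∎
    where open ≡-Reasoning
  ... | after h rewrite swap-after (length X) (length P) (length Q) h
    with k , refl ← ℕ.m≤n⇒∃[o]m+o≡n h = begin
    entry (X ++ (c ∷ Q) ++ (a ∷ P) ++ Z) (suc (suc (length X ℕ.+ length P ℕ.+ length Q)) ℕ.+ k)
      ≡⟨ cong (entry (X ++ (c ∷ Q) ++ (a ∷ P) ++ Z)) (eq₁ (length X) (length P) (length Q) k) ⟩
    entry (X ++ (c ∷ Q) ++ (a ∷ P) ++ Z) (length X ℕ.+ (suc (length Q) ℕ.+ (suc (length P) ℕ.+ k)))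
      ≡⟨ past X (c ∷ Q) (a ∷ P) ⟩
    entry Z k
      ≡⟨ past X (a ∷ P) (c ∷ Q) ⟨
    entry (X ++ (a ∷ P) ++ (c ∷ Q) ++ Z) (length X ℕ.+ (suc (length P) ℕ.+ (suc (length Q) ℕ.+ k)))
      ≡⟨ cong (entry (X ++ (a ∷ P) ++ (c ∷ Q) ++ Z)) (eq₂ (length X) (length P) (length Q) k) ⟨
    entry (X ++ (a ∷ P) ++ (c ∷ Q) ++ Z) (suc (suc (length X ℕ.+ length P ℕ.+ length Q)) ℕ.+ k) ∎
    where
    open ≡-Reasoning
    past : ∀ X U V → entry (X ++ U ++ V ++ Z) (length X ℕ.+ (length U ℕ.+ (length V ℕ.+ k))) ≡ entry Z k
    past X U V = trans (entry-++ʳ X _ _) (trans (entry-++ʳ U _ _) (entry-++ʳ V Z k))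
    eq₁ : ∀ l p q k → suc (suc (l ℕ.+ p ℕ.+ q)) ℕ.+ k ≡ l ℕ.+ (suc q ℕ.+ (suc p ℕ.+ k))
    eq₁ = solve-∀
    eq₂ : ∀ l p q k → suc (suc (l ℕ.+ p ℕ.+ q)) ℕ.+ k ≡ l ℕ.+ (suc p ℕ.+ (suc q ℕ.+ k))
    eq₂ = solve-∀

  -- Translates a factorisation with two nonempty middle blocks into positions, so that local
  -- optimality of a permutation covers all such factorisations.
  tabulate-blockSwap : ∀ {n} (h : Fin n → A) X a P c Q Z →
    tabulate h ≡ X ++ (a ∷ P) ++ (c ∷ Q) ++ Z →
    ∃ λ ℓ → ∃ λ m → ∃ λ r → ∃ λ (ℓ≤m : ℓ Fin.≤ m) → ∃ λ (m<r : m Fin.< r) →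
      tabulate (h ∘ (blockSwap ℓ m r ℓ≤m m<r ⟨$⟩ʳ_)) ≡ X ++ (c ∷ Q) ++ (a ∷ P) ++ Z
  tabulate-blockSwap {n} h X a P c Q Z eq = ℓ , m , r , ℓ≤m , m<r ,
    tabulate-unique _ _ (trans length-swap length-eq) λ i → begin
      entry (X ++ (c ∷ Q) ++ (a ∷ P) ++ Z) (toℕ i)
        ≡⟨ entry-swapIndex X a P c Q Z (toℕ i) ⟩
      entry (X ++ (a ∷ P) ++ (c ∷ Q) ++ Z) (swapIndex ℓ′ m′ r′ (toℕ i))
        ≡⟨ cong₂ entry (sym eq) (sym (index i)) ⟩
      entry (tabulate h) (toℕ (swapFin ℓ≤m m<r (toℕ<n r) i))
        ≡⟨ entry-tabulate h _ ⟩
      just (h (swapFin ℓ≤m m<r (toℕ<n r) i)) ∎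
    where
    open ≡-Reasoning
    -- Counting from 0, these are the first and last positions of `a ∷ P` and the last position of
    -- `c ∷ Q`.
    ℓ′ = length X
    m′ = ℓ′ ℕ.+ length P
    r′ = suc (m′ ℕ.+ length Q)

    length-eq : length (X ++ (a ∷ P) ++ (c ∷ Q) ++ Z) ≡ n
    length-eq = trans (cong length (sym eq)) (length-tabulate h)

    length-4 : ∀ (U V : List A) → length (X ++ U ++ V ++ Z) ≡
      length X ℕ.+ (length U ℕ.+ (length V ℕ.+ length Z))
    length-4 U V = trans (length-++ X) (cong (length X ℕ.+_)
      (trans (length-++ U) (cong (length U ℕ.+_) (length-++ V))))

    length-swap : length (X ++ (c ∷ Q) ++ (a ∷ P) ++ Z) ≡ length (X ++ (a ∷ P) ++ (c ∷ Q) ++ Z)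
    length-swap = trans (length-4 (c ∷ Q) (a ∷ P)) (trans
      (lemma (length X) (length P) (length Q) (length Z)) (sym (length-4 (a ∷ P) (c ∷ Q))))
      where
      lemma : ∀ l p q z → l ℕ.+ (suc q ℕ.+ (suc p ℕ.+ z)) ≡ l ℕ.+ (suc p ℕ.+ (suc q ℕ.+ z))
      lemma = solve-∀

    r′<n : r′ ℕ.< n
    r′<n = subst (r′ ℕ.<_)
      (trans (lemma (length X) (length P) (length Q) (length Z)) (trans (sym (length-4 (a ∷ P) (c ∷ Q))) length-eq))
      (ℕ.m≤m+n (suc r′) (length Z))
      where
      lemma : ∀ l p q z → suc (suc (l ℕ.+ p ℕ.+ q)) ℕ.+ z ≡ l ℕ.+ (suc p ℕ.+ (suc q ℕ.+ z))
      lemma = solve-∀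
    m′<r′ : m′ ℕ.< r′
    m′<r′ = ℕ.s≤s (ℕ.m≤m+n m′ (length Q))
    m′<n = ℕ.<-trans m′<r′ r′<n
    ℓ′<n = ℕ.≤-<-trans (ℕ.m≤m+n ℓ′ (length P)) m′<n

    ℓ = fromℕ< ℓ′<n
    m = fromℕ< m′<n
    r = fromℕ< r′<n

    ℓ≤m : ℓ Fin.≤ m
    ℓ≤m = subst₂ ℕ._≤_ (sym (toℕ-fromℕ< ℓ′<n)) (sym (toℕ-fromℕ< m′<n)) (ℕ.m≤m+n ℓ′ (length P))
    m<r : m Fin.< r
    m<r = subst₂ ℕ._<_ (sym (toℕ-fromℕ< m′<n)) (sym (toℕ-fromℕ< r′<n)) m′<r′

    index : ∀ i → toℕ (swapFin ℓ≤m m<r (toℕ<n r) i) ≡ swapIndex ℓ′ m′ r′ (toℕ i)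
    index i = trans (toℕ-swapFin ℓ≤m m<r (toℕ<n r) i)
      (trans (cong (λ ℓ → swapIndex ℓ (toℕ m) (toℕ r) (toℕ i)) (toℕ-fromℕ< ℓ′<n))
        (cong₂ (λ m r → swapIndex ℓ′ m r (toℕ i)) (toℕ-fromℕ< m′<n) (toℕ-fromℕ< r′<n)))

  tabulate-punchIn : ∀ {n} (h : Fin (suc n) → A) k →
    h k ∷ tabulate (h ∘ punchIn k) ↭ tabulate h
  tabulate-punchIn h zero = ↭-refl
  tabulate-punchIn {suc n} h (suc k) =
    ↭-trans (swap (h (suc k)) (h zero) ↭-refl) (prep (h zero) (tabulate-punchIn (h ∘ suc) k))

  -- Removing 0 and its image from `π` leaves a permutation of the remaining indices, which
  -- `punchIn` enumerates.
  tabulate-permute : ∀ {n} (h : Fin n → A) (π : Permutation′ n) → tabulate (h ∘ (π ⟨$⟩ʳ_)) ↭ tabulate h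
  tabulate-permute {zero}  h π = ↭-refl
  tabulate-permute {suc n} h π = ↭-trans
    (prep (h (π ⟨$⟩ʳ zero)) (↭-trans
      (↭-reflexive (tabulate-cong λ i → cong h (punchIn-permute π zero i)))
      (tabulate-permute (h ∘ punchIn (π ⟨$⟩ʳ zero)) (remove zero π))))
    (tabulate-punchIn h (π ⟨$⟩ʳ zero))

-- Compositions along a permutation

arrangement : ∀ {n} → (Fin n → LinearFunction) → Permutation′ n → List LinearFunction
arrangement f σ = tabulate (f ∘ (σ ⟨$⟩ʳ_))

opaque
  unfolding _⊕_ s

  s-resp-↭ : ∀ {A B} → A ↭ B → s A ≈ s B
  s-resp-↭ ↭.refl = ≈-refl
  s-resp-↭ (↭.prep f p) = pointwise λ i → cong (ℚ._* seq (slope f) i) (at (s-resp-↭ p) i)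
  s-resp-↭ (↭.swap {xs} f g p) = pointwise λ i → trans
    (eq (seq (s xs) i) (seq (slope g) i) (seq (slope f) i))
    (cong (λ x → x ℚ.* seq (slope f) i ℚ.* seq (slope g) i) (at (s-resp-↭ p) i))
    where
    eq : ∀ x y z → x ℚ.* y ℚ.* z ≡ x ℚ.* z ℚ.* y
    eq = solve 3 (λ x y z → x :* y :* z := x :* z :* y) refl
  s-resp-↭ (↭.trans p q) = ≈-trans (s-resp-↭ p) (s-resp-↭ q)

  foldl-apply : ∀ {m n} (f : Fin m → LinearFunction) (g : Fin n → Fin m) x →
    foldl (λ y i → apply (f i) y) x g ≈ s (tabulate (f ∘ g)) ⊗ x ⊕ b (tabulate (f ∘ g))
  foldl-apply {n = zero}  f g x = pointwise λ i → eq (seq x i)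
    where
    eq : ∀ x → x ≡ 1ℚ ℚ.* x ℚ.+ 0ℚ
    eq = solve 1 (λ x → x := con 1ℚ :* x :+ con 0ℚ) refl
  foldl-apply {n = suc n} f g x = pointwise λ i → trans
    (at (foldl-apply f (tail g) (apply (f (head g)) x)) i)
    (eq (seq (s (tabulate (f ∘ g ∘ suc))) i) (seq (b (tabulate (f ∘ g ∘ suc))) i)
      (seq (slope (f (g zero))) i) (seq (intercept (f (g zero))) i) (seq x i))
    where
    eq : ∀ s b a c x → s ℚ.* (a ℚ.* x ℚ.+ c) ℚ.+ b ≡ (s ℚ.* a) ℚ.* x ℚ.+ (s ℚ.* c ℚ.+ b)
    eq = solve 5 (λ s b a c x → s :* (a :* x :+ c) :+ b := (s :* a) :* x :+ (s :* c :+ b)) refl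

  x⊗𝟎⊕y≈y : ∀ x y → x ⊗ 0ℝ ⊕ y ≈ y
  x⊗𝟎⊕y≈y x y = pointwise λ i → eq (seq x i) (seq y i)
    where
    eq : ∀ x y → x ℚ.* 0ℚ ℚ.+ y ≡ y
    eq = solve 2 (λ x y → x :* con 0ℚ :+ y := y) refl

  ⊗-congʳ : ∀ {x y} z → x ≈ y → x ⊗ z ≈ y ⊗ z
  ⊗-congʳ z x≈y = pointwise λ i → cong (ℚ._* seq z i) (at x≈y i)

  ≤⇒≼ : ∀ x y → x ≤ y → x ≼ y
  ≤⇒≼ x y x≤y = x≤y

  ≼⇒≤ : ∀ x y → x ≼ y → x ≤ y
  ≼⇒≤ x y x≤y = x≤y

  nondecreasing⇒nonnegativeSlope : ∀ f → Nondecreasing f → NonnegativeSlope f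
  nondecreasing⇒nonnegativeSlope f 0≤a = 0≤a

compose-≈ : ∀ {n} (f : Fin n → LinearFunction) σ x →
  compose f σ x ≈ s (arrangement f σ) ⊗ x ⊕ b (arrangement f σ)
compose-≈ f σ x = foldl-apply f (σ ⟨$⟩ʳ_) x

compose-0 : ∀ {n} (f : Fin n → LinearFunction) σ → compose f σ 0ℝ ≈ b (arrangement f σ)
compose-0 f σ = ≈-trans (compose-≈ f σ 0ℝ) (x⊗𝟎⊕y≈y _ _)

-- Evaluation at 0 isolates the intercept.
b-≼-swapBlocks : ∀ {n} (f : Fin n → LinearFunction) σ → IsLocallyOptimal f σ → ∀ ℓ m r ℓ≤m m<r →
  b (arrangement f σ) ≼ b (arrangement f (swapBlocks σ ℓ m r ℓ≤m m<r))
b-≼-swapBlocks f σ lo ℓ m r ℓ≤m m<r =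
  x≈y≼z⇒x≼z (≈-sym (compose-0 f σ))
    (x≼y≈z⇒x≼z (≤⇒≼ (compose f σ 0ℝ) (compose f τ 0ℝ) (lo ℓ m r ℓ≤m m<r 0ℝ)) (compose-0 f τ))
  where
  τ = swapBlocks σ ℓ m r ℓ≤m m<r

isLocallyOptimal⇒locallyOptimal : ∀ {n} (f : Fin n → LinearFunction) σ →
  IsLocallyOptimal f σ → LocallyOptimal (arrangement f σ)
-- Swapping with an empty block changes nothing.
isLocallyOptimal⇒locallyOptimal f σ lo X []      B       Z eq = ≼-swap⇒0≼ X [] B Z ≼-refl
isLocallyOptimal⇒locallyOptimal f σ lo X (a ∷ P) []      Z eq = ≼-swap⇒0≼ X (a ∷ P) [] Z ≼-refl
isLocallyOptimal⇒locallyOptimal f σ lo X (a ∷ P) (c ∷ Q) Z eq =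
  let ℓ , m , r , ℓ≤m , m<r , eq′ = tabulate-blockSwap (f ∘ (σ ⟨$⟩ʳ_)) X a P c Q Z eq in
  ≼-swap⇒0≼ X (a ∷ P) (c ∷ Q) Z
    (subst₂ (λ A B → b A ≼ b B) eq eq′ (b-≼-swapBlocks f σ lo ℓ m r ℓ≤m m<r))

mainTheorem17 : (n : ℕ) (f : Fin n → LinearFunction) → (∀ i → Nondecreasing (f i)) →
    (σ : Permutation′ n) → IsMinimum f σ ⇔ IsLocallyOptimal f σ
mainTheorem17 n f nondecreasing σ = mk⇔
  (λ σ-min ℓ m r ℓ≤m m<r → σ-min (swapBlocks σ ℓ m r ℓ≤m m<r))
  -- Both composites have the same slope, so the inequality between intercepts carries over to every
  -- `x`.
  (λ lo ρ x → ≼⇒≤ (compose f σ x) (compose f ρ x) (x≈y≼z⇒x≼z (compose-≈ f σ x)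
    (x≼y≈z⇒x≼z
      (⊕-mono-≼ (≈⇒≼ (⊗-congʳ x (s-resp-↭ (↭-sym (ρ↭σ ρ))))) (optimal lo (arrangement f ρ) (ρ↭σ ρ)))
      (≈-sym (compose-≈ f ρ x)))))
  where
  ρ↭σ : ∀ ρ → arrangement f ρ ↭ arrangement f σ
  ρ↭σ ρ = ↭-trans (tabulate-permute f ρ) (↭-sym (tabulate-permute f σ))

  optimal : IsLocallyOptimal f σ → Optimal (arrangement f σ)
  optimal lo = locallyOptimal⇒optimal _ (arrangement f σ) refl
    (All.tabulate⁺ λ i → nondecreasing⇒nonnegativeSlope (f (σ ⟨$⟩ʳ i)) (nondecreasing (σ ⟨$⟩ʳ i)))
    (isLocallyOptimal⇒locallyOptimal f σ lo)
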